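{- Let ${}^*\mathbb{Q}$ be a field elementarily equivalent to $\mathbb{Q}$ (in the ring language), with ${}^*\mathbb{Z}$, ${}^*\mathbb{N}$, $\mathcal{P}({}^*\mathbb{N})$, the maps $d_p$ and the order $<$ as described in the context. For $a_0,a_1\in{}^*\mathbb{Q}\setminus\{0\}$, we have $a_0=a_1$ if and only if $d_p(a_0)=d_p(a_1)$ for all $p\in\mathcal{P}({}^*\mathbb{N})$ and $a_0a_1>0$. Equivalently, the map ${}^*\mathbb{Q}\setminus\{0\}\to\prod_{p\in\mathcal{P}({}^*\mathbb{N})}p^{{}^*\mathbb{Z}}\times\{\pm1\}$, $a\mapsto((d_p(a))_p,\operatorname{sgn}(a))$, is an injective group homomorphism, where $\operatorname{sgn}(a)=1$ if $a>0$ and $-1$ if $a<0$.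
   Context: Fix a first-order formula $Z(x)$ in the ring language defining $\mathbb{Z}$ in $\mathbb{Q}$ (such exists by J. Robinson). Let ${}^*\mathbb{Z}=Z({}^*\mathbb{Q})$ and let ${}^*\mathbb{N}$ be the set of elements of ${}^*\mathbb{Q}$ that are sums of four squares of elements of ${}^*\mathbb{Z}$. For $x,y\in{}^*\mathbb{Z}$, $x\mid y$ means $y=zx$ for some $z\in{}^*\mathbb{Z}$, $z\neq0$. $\mathcal{P}({}^*\mathbb{N})$ is the set of $p\in{}^*\mathbb{N}$, $p\ne1$, whose only divisors in ${}^*\mathbb{Z}$ are $\pm1,\pm p$. For such $p$, $p^{{}^*\mathbb{N}}$ is the set of $y\in{}^*\mathbb{N}$ such that $y=1$ or every $z\in{}^*\mathbb{N}$, $z\neq\pm1$, with $z\mid y$ satisfies $p\mid z$; and $p^{{}^*\mathbb{Z}}=p^{{}^*\mathbb{N}}\cup\{1/x:x\in p^{{}^*\mathbb{N}}\}$, a group under multiplication. For $x\in{}^*\mathbb{Z}\setminus\{0\}$, $d_p(x)$ is the unique $y\in p^{{}^*\mathbb{N}}$ with $y\mid x$ and $py\nmid x$; it is extended to ${}^*\mathbb{Q}\setminus\{0\}$ by $d_p(a/b)=d_p(a)/d_p(b)$ for $a,b\in{}^*\mathbb{Z}\setminus\{0\}$. The order on ${}^*\mathbb{Q}$: for $a_1,a_2\in{}^*\mathbb{Z}$ and $b_1,b_2\in{}^*\mathbb{N}\setminus\{0\}$, $a_1/b_1<a_2/b_2$ iff $a_2b_1-a_1b_2\in{}^*\mathbb{N}$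 (and they are distinct). -}

module Defs where

open import Algebra.Bundles using (CommutativeRing; Group; RawRing)
import Algebra.Construct.Pointwise as Pointwise
import Algebra.Morphism.GroupMonomorphism as GroupMonomorphism
open import Data.Empty.Polymorphic using (⊥)
open import Data.Fin using (Fin)
open import Data.Integer using (ℤ)
open import Data.Nat using (ℕ; suc)
open import Data.Product using (Σ; Σ-syntax; ∃-syntax; _×_; _,_; proj₁; proj₂)
open import Data.Rational as ℚ using (ℚ)
open import Data.Sign using (Sign)
open import Data.Sum using (_⊎_)
open import Data.Vec using (Vec; []; _∷_; lookup)
open import Function using (_⇔_)
open import Level using (Level; Lift; _⊔_) renaming (suc to lsuc)
open import Relation.Binary.PropositionalEquality using (_≡_)
import Relation.Binary.Reasoning.Setoid as ≈-Reasoning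
open import Relation.Nullary using (¬_)

-- First-order logic in the language of rings

infixl 6 _`+_
infixl 7 _`*_
infix  8 `-_
infix  4 _`≈_
infixr 3 _`∧_
infixr 2 _`∨_
infixr 1 _`⇒_
infix  0 `∀_ `∃_

data Term (n : ℕ) : Set where
  var         : Fin n → Term n
  `0 `1       : Term n
  _`+_ _`*_   : Term n → Term n → Term n
  `-_         : Term n → Term n

-- Formula n: free variables among n de Bruijn indices, index 0 being the
-- one bound by the innermost quantifier.
data Formula : ℕ → Set where
  _`≈_             : ∀ {n} → Term n → Term n → Formula n
  `⊥               : ∀ {n} → Formula n
  _`∧_ _`∨_ _`⇒_   : ∀ {n} → Formula n → Formula n → Formula n
  `∀_ `∃_          : ∀ {n} → Formula (suc n) → Formula n

module _ {c ℓ : Level} (M : RawRing c ℓ) where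
  open RawRing M

  eval : ∀ {n} → Vec Carrier n → Term n → Carrier
  eval ρ (var i)  = lookup ρ i
  eval ρ `0       = 0#
  eval ρ `1       = 1#
  eval ρ (s `+ t) = eval ρ s + eval ρ t
  eval ρ (s `* t) = eval ρ s * eval ρ t
  eval ρ (`- t)   = - eval ρ t

  -- Tarski satisfaction. Equality symbols are read as the setoid equality of M;
  -- connectives and quantifiers as Agda's, with which Tarski's clauses agree
  -- verbatim (and which are the classical ones in a classical metatheory).
  Sat : ∀ {n} → Vec Carrier n → Formula n → Set (c ⊔ ℓ)
  Sat ρ (s `≈ t) = Lift c (eval ρ s ≈ eval ρ t)
  Sat ρ `⊥       = ⊥
  Sat ρ (φ `∧ ψ) = Sat ρ φ × Sat ρ ψ
  Sat ρ (φ `∨ ψ) = Sat ρ φ ⊎ Sat ρ ψ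
  Sat ρ (φ `⇒ ψ) = Sat ρ φ → Sat ρ ψ
  Sat ρ (`∀ φ)   = ∀ x → Sat (x ∷ ρ) φ
  Sat ρ (`∃ φ)   = ∃[ x ] Sat (x ∷ ρ) φ

ElementarilyEquivalent : ∀ {c ℓ c′ ℓ′} → RawRing c ℓ → RawRing c′ ℓ′ → Set (c ⊔ ℓ ⊔ c′ ⊔ ℓ′)
ElementarilyEquivalent M N = (φ : Formula 0) → Sat M [] φ ⇔ Sat N [] φ

DefinesℤInℚ : Formula 1 → Set
DefinesℤInℚ Z = (q : ℚ) → Sat ℚ.+-*-rawRing (q ∷ []) Z ⇔ (∃[ n ] q ≡ n ℚ./ 1)

record Field (c ℓ : Level) : Set (lsuc (c ⊔ ℓ)) where
  field
    commutativeRing : CommutativeRing c ℓ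
  open CommutativeRing commutativeRing public
  field
    1≉0     : ¬ (1# ≈ 0#)
    inverse : ∀ x → ¬ (x ≈ 0#) → ∃[ y ] x * y ≈ 1#

module _ {c ℓ : Level} (G : Group c ℓ) where
  open Group G

  record IsSubgroup {p : Level} (H : Carrier → Set p) : Set (c ⊔ p) where
    field
      ε-closed  : H ε
      ∙-closed  : ∀ x y → H x → H y → H (x ∙ y)
      ⁻¹-closed : ∀ x → H x → H (x ⁻¹)

  subgroup : ∀ {p} {H : Carrier → Set p} → IsSubgroup H → Group (c ⊔ p) ℓ
  subgroup {p} {H} sub = record
    { Carrier = Σ Carrier H
    ; _≈_     = λ x y → proj₁ x ≈ proj₁ y
    ; _∙_     = λ x y → (proj₁ x ∙ proj₁ y) , ∙-closed _ _ (proj₂ x) (proj₂ y)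
    ; ε       = ε , ε-closed
    ; _⁻¹     = λ x → (proj₁ x ⁻¹) , ⁻¹-closed _ (proj₂ x)
    ; isGroup = GroupMonomorphism.isGroup
        (record
          { isGroupHomomorphism = record
            { isMonoidHomomorphism = record
              { isMagmaHomomorphism = record
                { isRelHomomorphism = record { cong = λ e → e }
                ; homo = λ _ _ → refl
                }
              ; ε-homo = refl
              }
            ; ⁻¹-homo = λ _ → refl
            }
          ; injective = λ e → e
          })
        isGroup
    }
    where open IsSubgroup sub

-- The multiplicative group of nonzero elements.
module _ {c ℓ : Level} (F : Field c ℓ) where
  open Field F
  open ≈-Reasoning setoid

  private
    Nonzero : Carrier → Set ℓ
    Nonzero x = ¬ (x ≈ 0#)

    *-nonzero : ∀ {x y} → Nonzero x → Nonzero y → Nonzero (x * y)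
    *-nonzero {x} {y} x≉0 y≉0 xy≈0 with inverse y y≉0
    ... | y′ , yy′≈1 = x≉0 (begin
      x            ≈⟨ *-identityʳ x ⟨
      x * 1#       ≈⟨ *-congˡ yy′≈1 ⟨
      x * (y * y′) ≈⟨ *-assoc x y y′ ⟨
      (x * y) * y′ ≈⟨ *-congʳ xy≈0 ⟩
      0# * y′      ≈⟨ zeroˡ y′ ⟩
      0#           ∎)

    inverse-nonzero : ∀ {x y} → x * y ≈ 1# → Nonzero y
    inverse-nonzero {x} {y} xy≈1 y≈0 = 1≉0 (begin
      1#     ≈⟨ xy≈1 ⟨
      x * y  ≈⟨ *-congˡ y≈0 ⟩
      x * 0# ≈⟨ zeroʳ x ⟩
      0#     ∎)

    inverse-cong : ∀ {x x′ y y′} → x * y ≈ 1# → x′ * y′ ≈ 1# → x ≈ x′ → y ≈ y′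
    inverse-cong {x} {x′} {y} {y′} xy≈1 x′y′≈1 x≈x′ = begin
      y             ≈⟨ *-identityʳ y ⟨
      y * 1#        ≈⟨ *-congˡ x′y′≈1 ⟨
      y * (x′ * y′) ≈⟨ *-assoc y x′ y′ ⟨
      (y * x′) * y′ ≈⟨ *-congʳ (*-congˡ (sym x≈x′)) ⟩
      (y * x) * y′  ≈⟨ *-congʳ (trans (*-comm y x) xy≈1) ⟩
      1# * y′       ≈⟨ *-identityˡ y′ ⟩
      y′            ∎

  multiplicativeGroup : Group (c ⊔ ℓ) ℓ
  multiplicativeGroup = record
    { Carrier = Σ Carrier Nonzero
    ; _≈_     = λ x y → proj₁ x ≈ proj₁ y
    ; _∙_     = λ x y → (proj₁ x * proj₁ y) , *-nonzero (proj₂ x) (proj₂ y)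
    ; ε       = 1# , 1≉0
    ; _⁻¹     = λ { (x , x≉0) → let (y , xy≈1) = inverse x x≉0 in y , inverse-nonzero xy≈1 }
    ; isGroup = record
      { isMonoid = record
        { isSemigroup = record
          { isMagma = record
            { isEquivalence = record { refl = refl ; sym = sym ; trans = trans }
            ; ∙-cong        = *-cong
            }
          ; assoc = λ x y z → *-assoc (proj₁ x) (proj₁ y) (proj₁ z)
          }
        ; identity = (λ x → *-identityˡ (proj₁ x)) , (λ x → *-identityʳ (proj₁ x))
        }
      ; inverse = (λ { (x , x≉0) → trans (*-comm _ x) (proj₂ (inverse x x≉0)) })
                , (λ { (x , x≉0) → proj₂ (inverse x x≉0) })
      ; ⁻¹-cong = λ { {x , x≉0} {y , y≉0} →
                      inverse-cong (proj₂ (inverse x x≉0)) (proj₂ (inverse y y≉0)) }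
      }
    }

module Arithmetic {c ℓ : Level} (*ℚ : Field c ℓ) (Z : Formula 1) where
  open Field *ℚ

  *ℚˣ : Group (c ⊔ ℓ) ℓ
  *ℚˣ = multiplicativeGroup *ℚ

  module ˣ = Group *ℚˣ

  *ℤ : Carrier → Set (c ⊔ ℓ)
  *ℤ x = Sat rawRing (x ∷ []) Z

  *ℕ : Carrier → Set (c ⊔ ℓ)
  *ℕ x = ∃[ a ] ∃[ b ] ∃[ e ] ∃[ f ]
           *ℤ a × *ℤ b × *ℤ e × *ℤ f × x ≈ a * a + b * b + e * e + f * f

  -- The quotient z is required to be nonzero, so 0 is divisible only by 0.
  infix 4 _∣_
  _∣_ : Carrier → Carrier → Set (c ⊔ ℓ)
  x ∣ y = ∃[ z ] *ℤ z × ¬ (z ≈ 0#) × y ≈ z * x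

  -- The divisors of p are exactly ±1 and ±p. The backward implication
  -- excludes p = 0, whose only divisor is 0; for all other p ∈ *ℕ it is automatic.
  IsPrime : Carrier → Set (c ⊔ ℓ)
  IsPrime p = *ℕ p × ¬ (p ≈ 1#) ×
    (∀ x → *ℤ x → x ∣ p ⇔ (x ≈ 1# ⊎ x ≈ - 1# ⊎ x ≈ p ⊎ x ≈ - p))

  Primes : Set (c ⊔ ℓ)
  Primes = Σ Carrier IsPrime

  infix 8 _^*ℕ _^*ℤ
  _^*ℕ : Primes → Carrier → Set (c ⊔ ℓ)
  ((p , _) ^*ℕ) y = *ℕ y ×
    (y ≈ 1# ⊎ (∀ z → *ℕ z → ¬ (z ≈ 1#) → ¬ (z ≈ - 1#) → z ∣ y → p ∣ z))

  _^*ℤ : Primes → ˣ.Carrier → Set (c ⊔ ℓ)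
  (p ^*ℤ) u = (p ^*ℕ) (proj₁ u) ⊎ (∃[ x ] (p ^*ℕ) (proj₁ x) × u ˣ.≈ x ˣ.⁻¹)

  record Is-d (p : Primes) (d : ˣ.Carrier → ˣ.Carrier) : Set (c ⊔ ℓ) where
    ExactDivisor : Carrier → Carrier → Set (c ⊔ ℓ)
    ExactDivisor x y = (p ^*ℕ) y × y ∣ x × ¬ (proj₁ p * y ∣ x)
    field
      d-cong        : ∀ a b → a ˣ.≈ b → d a ˣ.≈ d b
      d-on-integer  : ∀ x → *ℤ (proj₁ x) →
                      ExactDivisor (proj₁ x) (proj₁ (d x)) ×
                      (∀ y → ExactDivisor (proj₁ x) y → y ≈ proj₁ (d x))
      d-on-quotient : ∀ a b → *ℤ (proj₁ a) → *ℤ (proj₁ b) →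
                      d (a ˣ.// b) ˣ.≈ (d a ˣ.// d b)

  infix 4 _<_
  _<_ : Carrier → Carrier → Set (c ⊔ ℓ)
  x < y = ∃[ a₁ ] ∃[ a₂ ] ∃[ b₁ ] ∃[ b₂ ]
    *ℤ a₁ × *ℤ a₂ ×
    *ℕ (proj₁ b₁) × *ℕ (proj₁ b₂) ×
    x ≈ a₁ * proj₁ (b₁ ˣ.⁻¹) × y ≈ a₂ * proj₁ (b₂ ˣ.⁻¹) ×
    *ℕ (a₂ * proj₁ b₁ - a₁ * proj₁ b₂) × ¬ (x ≈ y)

  record Is-sgn (sgn : ˣ.Carrier → Sign) : Set (c ⊔ ℓ) where
    field
      sgn-positive : ∀ a → 0# < proj₁ a → sgn a ≡ Sign.+
      sgn-negative : ∀ a → proj₁ a < 0# → sgn a ≡ Sign.-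

  -- Families of elements of p ^*ℤ indexed by the primes p. As a prime carries
  -- a proof of primality and lives in a setoid, a family must respect the
  -- equality of primes.
  InProduct : (Primes → ˣ.Carrier) → Set (c ⊔ ℓ)
  InProduct f = (∀ p → (p ^*ℤ) (f p)) × (∀ p q → proj₁ p ≈ proj₁ q → f p ˣ.≈ f q)

  product-isSubgroup : (∀ p → IsSubgroup *ℚˣ (p ^*ℤ)) →
                       IsSubgroup (Pointwise.group Primes *ℚˣ) InProduct
  product-isSubgroup sub = record
    { ε-closed  = (λ p → IsSubgroup.ε-closed (sub p)) , (λ _ _ _ → refl)
    ; ∙-closed  = λ f g (f∈ , f-cong) (g∈ , g-cong) →
                    (λ p → IsSubgroup.∙-closed (sub p) (f p) (g p) (f∈ p) (g∈ p))
                  , (λ p q p≈q → *-cong (f-cong p q p≈q) (g-cong p q p≈q))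
    ; ⁻¹-closed = λ f (f∈ , f-cong) →
                    (λ p → IsSubgroup.⁻¹-closed (sub p) (f p) (f∈ p))
                  , (λ p q p≈q → ˣ.⁻¹-cong {f p} {f q} (f-cong p q p≈q))
    }

  -- ∏ₚ p ^*ℤ
  productGroup : (∀ p → IsSubgroup *ℚˣ (p ^*ℤ)) → Group (c ⊔ ℓ) (c ⊔ ℓ)
  productGroup sub = subgroup (Pointwise.group Primes *ℚˣ) (product-isSubgroup sub)

{-# OPTIONS --safe #-}

-- Relativising quantifiers to Z transfers every first-order sentence true in ℤ to *ℤ. This gives in *ℤ
-- Lagrange's theorem (so that *ℕ consists of the nonnegative elements), reduction of fractions to lowest terms,
-- prime factors, Euclid's lemma, and the existence and uniqueness of the p-part of an integer. As satisfaction
-- is read constructively, the transferred existence statements provide the functions d_p and sgn.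
-- If d_p(a₀/a₁) = 1 for all p, write a₀/a₁ = x/y in lowest terms. A prime p ∣ x would not divide y, so
-- d_p(x/y) = d_p(x) ≠ 1; hence x, and likewise y, is a unit. Thus a₀ = ± a₁, and the sign of a₀a₁ decides.

module Submission where

open import Defs
open import Algebra.Bundles using (Group; RawRing)
open import Algebra.Construct.DirectProduct using () renaming (group to _×ᴳ_)
open import Algebra.Morphism.Structures using (IsGroupHomomorphism; IsGroupMonomorphism)
import Algebra.Properties.Group as GroupProperties
open import Data.Empty using (⊥-elim)
open import Data.Fin using (Fin; zero; suc; _↑ˡ_)
import Data.Integer as ℤ
open import Data.Integer using (ℤ)
open import Data.Nat as ℕ using (ℕ; suc)
import Data.Nat.Properties as ℕ
open import Data.Product using (Σ; Σ-syntax; ∃-syntax; _×_; _,_; proj₁; proj₂)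
import Data.Rational as ℚ
open import Data.Rational using (+-*-rawRing)
open import Data.Sign using (Sign) renaming (_*_ to _*ˢ_)
open import Data.Sign.Properties using () renaming (*-group to signGroup)
open import Data.Sum as Sum using (_⊎_; inj₁; inj₂; [_,_]′)
open import Function using (_⇔_; mk⇔; Equivalence; id; _∘_)
open import Level using (Level; _⊔_; 0ℓ; lift; lower)
open import Relation.Binary.PropositionalEquality as ≡ using (_≡_)
import Relation.Binary.Reasoning.Setoid as ≈-Reasoning
open import Relation.Nullary using (¬_; yes; no)

open Equivalence using (to; from)

-- So every argument by descent is carried out in ℤ, and what crosses over must be a single sentence
-- of the ring language. This is why powers of p are described through their divisors and never
-- through exponents, and why the p-part is described by a cofactor that p does not divide. The
-- predicates of `Divisibility` are parametrised by a ring and a map into it, so that one definition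
-- serves for ℤ itself and for `*ℤ` inside `*ℚ`, and matches the satisfaction of one formula on both
-- sides. The metatheory is constructive and `*ℚ` is a setoid: decidability of `≈` and invariance of
-- `*ℤ` under `≈` are themselves obtained as sentences true in ℚ. The arithmetic is done for one
-- explicitly built `valuation`; any `d` with `Is-d` is then shown to coincide with it.

-- The image of ι plays the role of the ring of integers of R.
module Divisibility {c ℓ i} (R : RawRing c ℓ) (I : Set i) (ι : I → RawRing.Carrier R) where
  private module R = RawRing R
  open R using (Carrier; _≈_; 0#; 1#)

  Unit : Carrier → Set ℓ
  Unit x = x ≈ 1# ⊎ x ≈ R.- 1#

  Multiple : Carrier → Carrier → Set (i ⊔ ℓ)
  Multiple p x = ∃[ k ] x ≈ ι k R.* p

  Irreducible : Carrier → Set (i ⊔ ℓ)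
  Irreducible p = ¬ (p ≈ 0#) × ¬ Unit p ×
    (∀ a b → p ≈ ι b R.* ι a → ι a ≈ 1# ⊎ ι a ≈ R.- 1# ⊎ ι a ≈ p ⊎ ι a ≈ R.- p)

  FourSquares : Carrier → Set (i ⊔ ℓ)
  FourSquares x = ∃[ a ] ∃[ b ] ∃[ e ] ∃[ f ]
    x ≈ ι a R.* ι a R.+ ι b R.* ι b R.+ ι e R.* ι e R.+ ι f R.* ι f

  -- For prime p these are the powers of p. No exponent occurs, so the condition is directly a
  -- formula of the ring language; y = 1 is included because all its divisors are units.
  Power : Carrier → Carrier → Set (i ⊔ ℓ)
  Power p y = ¬ (y ≈ 0#) × FourSquares y × (∀ w u → y ≈ ι u R.* ι w → Unit (ι w) ⊎ Multiple p (ι w))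

  -- For x and y nonzero this amounts to: y divides x, but p y does not. With the cofactor as
  -- witness, multiplicativity reduces to Euclid's lemma.
  ExactCofactor : Carrier → Carrier → Carrier → Set (i ⊔ ℓ)
  ExactCofactor p x y = ∃[ z ] x ≈ ι z R.* y × ¬ Multiple p (ι z)

-- Lagrange's four-square theorem in ℤ

module LagrangeFourSquares where
  import Data.Fin as Fin
  import Data.Fin.Properties as Fin
  open import Data.Integer hiding (suc; NonZero; _⊔_)
  open import Data.Integer.DivMod using (_%ℕ_; _/ℕ_; n%ℕd<d; a≡a%ℕn+[a/ℕn]*n)
  open import Data.Integer.Properties
  open import Data.Integer.Tactic.RingSolver using (solve-∀)
  open import Data.List using ([]; _∷_)
  open import Data.List.Relation.Unary.All using (All; []; _∷_)
  open import Data.Nat using (zero; NonZero)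
  import Data.Nat.Divisibility as ℕ
  import Data.Nat.DivMod as ℕ
  import Data.Nat.Induction as ℕ
  open import Data.Nat.ListAction using (product)
  open import Data.Nat.Primality using (Prime; euclidsLemma; prime⇒nonZero; prime⇒nonTrivial; prime⇒irreducible)
  open import Data.Nat.Primality.Factorisation using (PrimeFactorisation; factorise)
  import Data.Nat.Tactic.RingSolver as ℕSolver
  open import Data.Sum using (reduce)
  open import Relation.Binary using (tri<; tri≈; tri>)
  open import Relation.Binary.PropositionalEquality

  open Divisibility ℤ.+-*-rawRing ℤ id using (FourSquares)

  -- Multiplicativity of the quaternion norm, applied to y times the conjugate of x, where x has
  -- coordinates a, b, e, f and y has the primed ones. Because of the conjugation the first square
  -- is that of the inner product, the form in which the descent meets it.
  euler-identity : ∀ a b e f a′ b′ e′ f′ →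
    (a * a + b * b + e * e + f * f) * (a′ * a′ + b′ * b′ + e′ * e′ + f′ * f′) ≡
    (a * a′ + b * b′ + e * e′ + f * f′) * (a * a′ + b * b′ + e * e′ + f * f′)
    + (a * b′ - b * a′ + e * f′ - f * e′) * (a * b′ - b * a′ + e * f′ - f * e′)
    + (a * e′ - e * a′ + f * b′ - b * f′) * (a * e′ - e * a′ + f * b′ - b * f′)
    + (a * f′ - f * a′ + b * e′ - e * b′) * (a * f′ - f * a′ + b * e′ - e * b′)
  euler-identity = solve-∀

  -- The real part and the first imaginary part of that quaternion product. The other two imaginary
  -- parts arise from `cross` by cyclic permutation of the last three coordinates.
  inner cross : ℤ → ℤ → ℤ → ℤ → ℤ → ℤ → ℤ → ℤ → ℤ
  inner a b e f a′ b′ e′ f′ = a * a′ + b * b′ + e * e′ + f * f′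
  cross a b e f a′ b′ e′ f′ = a * b′ - b * a′ + e * f′ - f * e′

  fourSquares-* : ∀ {x y} → FourSquares x → FourSquares y → FourSquares (x * y)
  fourSquares-* (a , b , e , f , refl) (a′ , b′ , e′ , f′ , refl) =
    inner a b e f a′ b′ e′ f′ , cross a b e f a′ b′ e′ f′ ,
    cross a e f b a′ e′ f′ b′ , cross a f b e a′ f′ b′ e′ ,
    euler-identity a b e f a′ b′ e′ f′

  -- The descent step: a smaller multiplier of a prime

  i*i≡+∣i∣*∣i∣ : ∀ i → i * i ≡ + (∣ i ∣ ℕ.* ∣ i ∣)
  i*i≡+∣i∣*∣i∣ (+ n)    = sym (pos-* n n)
  i*i≡+∣i∣*∣i∣ -[1+ n ] = refl

  norm≡+ : ∀ a b e f → a * a + b * b + e * e + f * f ≡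
    + (∣ a ∣ ℕ.* ∣ a ∣ ℕ.+ ∣ b ∣ ℕ.* ∣ b ∣ ℕ.+ ∣ e ∣ ℕ.* ∣ e ∣ ℕ.+ ∣ f ∣ ℕ.* ∣ f ∣)
  norm≡+ a b e f
    rewrite i*i≡+∣i∣*∣i∣ a | i*i≡+∣i∣*∣i∣ b | i*i≡+∣i∣*∣i∣ e | i*i≡+∣i∣*∣i∣ f = refl

  -- y lies in the half-open interval (-m/2, m/2], so 2y = -m does not occur.
  centredResidue : ∀ m .{{_ : NonZero m}} x →
    ∃[ y ] ∃[ k ] x ≡ y + k * + m × (2 ℕ.* ∣ y ∣ ℕ.< m ⊎ + 2 * y ≡ + m)
  centredResidue m x with ℕ.<-cmp (2 ℕ.* (x %ℕ m)) m
  ... | tri< 2r<m _ _ = + (x %ℕ m) , x /ℕ m , a≡a%ℕn+[a/ℕn]*n x m , inj₁ 2r<m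
  ... | tri≈ _ 2r≡m _ = + (x %ℕ m) , x /ℕ m , a≡a%ℕn+[a/ℕn]*n x m ,
    inj₂ (trans (sym (pos-* 2 (x %ℕ m))) (cong +_ 2r≡m))
  ... | tri> _ _ m<2r = - + s , + 1 + x /ℕ m , x≡ , inj₁ (subst (λ t → 2 ℕ.* t ℕ.< m) (sym (∣-i∣≡∣i∣ (+ s))) 2s<m)
    where
    r = x %ℕ m
    s = m ℕ.∸ r

    r+s≡m : r ℕ.+ s ≡ m
    r+s≡m = ℕ.m+[n∸m]≡n (ℕ.<⇒≤ (n%ℕd<d x m))

    shift : ∀ r s q → r + q * (r + s) ≡ - s + (+ 1 + q) * (r + s)
    shift = solve-∀

    x≡ : x ≡ - + s + (+ 1 + x /ℕ m) * + m
    x≡ = trans (a≡a%ℕn+[a/ℕn]*n x m)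
      (subst (λ t → + r + x /ℕ m * t ≡ - + s + (+ 1 + x /ℕ m) * t)
        (cong +_ r+s≡m) (shift (+ r) (+ s) (x /ℕ m)))

    s<r : s ℕ.< r
    s<r = ℕ.+-cancelˡ-< r s r
      (subst₂ ℕ._<_ (sym r+s≡m) (cong (r ℕ.+_) (ℕ.+-identityʳ r)) m<2r)

    2s<m : 2 ℕ.* s ℕ.< m
    2s<m = subst₂ ℕ._<_ (cong (s ℕ.+_) (sym (ℕ.+-identityʳ s))) r+s≡m (ℕ.+-monoˡ-< s s<r)

  module _ (m a b e f : ℕ) (2a<m : 2 ℕ.* a ℕ.< m)
           (2b≤m : 2 ℕ.* b ℕ.≤ m) (2e≤m : 2 ℕ.* e ℕ.≤ m) (2f≤m : 2 ℕ.* f ℕ.≤ m) where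

    -- Four times the sum is (2a)² + (2b)² + (2e)² + (2f)², where each square is at most m². One
    -- strict bound makes the total strict, which isolates the case that all four bounds are
    -- attained.
    sumOfSquares<m² : a ℕ.* a ℕ.+ b ℕ.* b ℕ.+ e ℕ.* e ℕ.+ f ℕ.* f ℕ.< m ℕ.* m
    sumOfSquares<m² = ℕ.*-cancelˡ-< 4 _ _ (subst₂ ℕ._<_ (lhs a b e f) (rhs m)
      (ℕ.+-mono-<-≤ (ℕ.+-mono-<-≤ (ℕ.+-mono-<-≤ (ℕ.*-mono-< 2a<m 2a<m)
        (ℕ.*-mono-≤ 2b≤m 2b≤m)) (ℕ.*-mono-≤ 2e≤m 2e≤m)) (ℕ.*-mono-≤ 2f≤m 2f≤m)))
      where
      lhs : ∀ a b e f →
        2 ℕ.* a ℕ.* (2 ℕ.* a) ℕ.+ 2 ℕ.* b ℕ.* (2 ℕ.* b) ℕ.+ 2 ℕ.* e ℕ.* (2 ℕ.* e) ℕ.+ 2 ℕ.* f ℕ.* (2 ℕ.* f)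
        ≡ 4 ℕ.* (a ℕ.* a ℕ.+ b ℕ.* b ℕ.+ e ℕ.* e ℕ.+ f ℕ.* f)
      lhs = ℕSolver.solve-∀
      rhs : ∀ m → m ℕ.* m ℕ.+ m ℕ.* m ℕ.+ m ℕ.* m ℕ.+ m ℕ.* m ≡ 4 ℕ.* (m ℕ.* m)
      rhs = ℕSolver.solve-∀

  prime-no-multiple : ∀ {p m} → Prime p → 1 ℕ.< m → m ℕ.< p → ∀ t → + p ≢ + m * t
  prime-no-multiple {p} {m} pp 1<m m<p t eq
    with prime⇒irreducible pp (ℕ.divides ∣ t ∣ (trans (trans (cong ∣_∣ eq) (abs-* (+ m) t)) (ℕ.*-comm m ∣ t ∣)))
  ... | inj₁ refl = ℕ.<-irrefl refl 1<m
  ... | inj₂ refl = ℕ.<-irrefl refl m<p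

  -- With mp = Σ (yᵢ + kᵢ m)² and Σ yᵢ² = mr one has p = r + 2S + mK, so that
  -- rp = (r + S)² + (Σ kᵢ² Σ yᵢ² - S²), where Euler's identity makes the last bracket a sum of three squares.
  module Descent (p m : ℕ) (pp : Prime p) (1<m : 1 ℕ.< m) (m<p : m ℕ.< p)
    (y₁ y₂ y₃ y₄ k₁ k₂ k₃ k₄ : ℤ)
    (mp≡ : + m * + p ≡ (y₁ + k₁ * + m) * (y₁ + k₁ * + m) + (y₂ + k₂ * + m) * (y₂ + k₂ * + m)
                     + (y₃ + k₃ * + m) * (y₃ + k₃ * + m) + (y₄ + k₄ * + m) * (y₄ + k₄ * + m))
    where

    instance
      m≢0 : NonZero m
      m≢0 = ℕ.>-nonZero (ℕ.<-trans (ℕ.s≤s ℕ.z≤n) 1<m)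

    S K R : ℤ
    S = inner k₁ k₂ k₃ k₄ y₁ y₂ y₃ y₄
    K = k₁ * k₁ + k₂ * k₂ + k₃ * k₃ + k₄ * k₄
    R = + p - (+ 2 * S + + m * K)

    X N : ℤ
    X = (y₁ + k₁ * + m) * (y₁ + k₁ * + m) + (y₂ + k₂ * + m) * (y₂ + k₂ * + m)
      + (y₃ + k₃ * + m) * (y₃ + k₃ * + m) + (y₄ + k₄ * + m) * (y₄ + k₄ * + m)
    N = y₁ * y₁ + y₂ * y₂ + y₃ * y₃ + y₄ * y₄

    n : ℕ
    n = ∣ y₁ ∣ ℕ.* ∣ y₁ ∣ ℕ.+ ∣ y₂ ∣ ℕ.* ∣ y₂ ∣ ℕ.+ ∣ y₃ ∣ ℕ.* ∣ y₃ ∣ ℕ.+ ∣ y₄ ∣ ℕ.* ∣ y₄ ∣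

    -- As `R` is a polynomial in the data, expanding the squares in `mp≡` exhibits N as a multiple
    -- of m without any division.
    N≡mR : N ≡ + m * R
    N≡mR = begin
      N                                               ≡⟨ cancel N (+ m) (+ 2 * S + + m * K) ⟩
      (N + + m * (+ 2 * S + + m * K)) - + m * (+ 2 * S + + m * K)
        ≡⟨ cong (_- + m * (+ 2 * S + + m * K)) (trans mp≡ X≡) ⟨
      + m * + p - + m * (+ 2 * S + + m * K)           ≡⟨ factor (+ m) (+ p) (+ 2 * S + + m * K) ⟩
      + m * R                                         ∎
      where
      open ≡-Reasoning
      square : ∀ y k m → (y + k * m) * (y + k * m) ≡ y * y + m * (+ 2 * (k * y) + m * (k * k))
      square = solve-∀
      collect : ∀ m a₁ a₂ s₁ s₂ t₁ t₂ →
        a₁ + m * (+ 2 * s₁ + m * t₁) + (a₂ + m * (+ 2 * s₂ + m * t₂)) ≡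
        a₁ + a₂ + m * (+ 2 * (s₁ + s₂) + m * (t₁ + t₂))
      collect = solve-∀
      X≡ : X ≡ N + + m * (+ 2 * S + + m * K)
      X≡ = trans (cong₂ _+_ (trans (cong₂ _+_ (trans (cong₂ _+_ (square y₁ k₁ (+ m)) (square y₂ k₂ (+ m)))
             (collect (+ m) (y₁ * y₁) (y₂ * y₂) (k₁ * y₁) (k₂ * y₂) (k₁ * k₁) (k₂ * k₂))) (square y₃ k₃ (+ m)))
             (collect (+ m) (y₁ * y₁ + y₂ * y₂) (y₃ * y₃) (k₁ * y₁ + k₂ * y₂) (k₃ * y₃) (k₁ * k₁ + k₂ * k₂) (k₃ * k₃)))
             (square y₄ k₄ (+ m)))
           (collect (+ m) (y₁ * y₁ + y₂ * y₂ + y₃ * y₃) (y₄ * y₄)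
             (k₁ * y₁ + k₂ * y₂ + k₃ * y₃) (k₄ * y₄) (k₁ * k₁ + k₂ * k₂ + k₃ * k₃) (k₄ * k₄))
      cancel : ∀ n m u → n ≡ (n + m * u) - m * u
      cancel = solve-∀
      factor : ∀ m p t → m * p - m * t ≡ m * (p - t)
      factor = solve-∀

    r : ℕ
    r = ∣ R ∣

    n≡mr : n ≡ m ℕ.* r
    n≡mr = trans (cong ∣_∣ (trans (sym (norm≡+ y₁ y₂ y₃ y₄)) N≡mR)) (abs-* (+ m) R)

    -- `R` is nonnegative because m R = N is a sum of squares and m is positive.
    R≡r : R ≡ + r
    R≡r = *-cancelˡ-≡ (+ m) R (+ r) (trans (sym N≡mR)
      (trans (norm≡+ y₁ y₂ y₃ y₄) (trans (cong +_ n≡mr) (pos-* m r))))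

    p≡ : + p ≡ + r + + 2 * S + + m * K
    p≡ = trans (move (+ p) (+ 2 * S) (+ m * K)) (cong (λ t → t + + 2 * S + + m * K) R≡r)
      where
      move : ∀ p s t → p ≡ p - (s + t) + s + t
      move = solve-∀

    C₁ C₂ C₃ : ℤ
    C₁ = cross k₁ k₂ k₃ k₄ y₁ y₂ y₃ y₄
    C₂ = cross k₁ k₃ k₄ k₂ y₁ y₃ y₄ y₂
    C₃ = cross k₁ k₄ k₂ k₃ y₁ y₄ y₂ y₃

    fourSquares-r*p : FourSquares (+ r * + p)
    fourSquares-r*p = + r + S , C₁ , C₂ , C₃ , (begin
      + r * + p                                       ≡⟨ cong (+ r *_) p≡ ⟩
      + r * (+ r + + 2 * S + + m * K)                 ≡⟨ left (+ r) S (+ m) K ⟩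
      + r * + r + + 2 * + r * S + K * (+ m * + r)
        ≡⟨ cong (λ t → + r * + r + + 2 * + r * S + K * t) (trans (cong (+ m *_) (sym R≡r)) (sym N≡mR)) ⟩
      + r * + r + + 2 * + r * S + K * N
        ≡⟨ cong (λ t → + r * + r + + 2 * + r * S + t) (euler-identity k₁ k₂ k₃ k₄ y₁ y₂ y₃ y₄) ⟩
      + r * + r + + 2 * + r * S + (S * S + C₁ * C₁ + C₂ * C₂ + C₃ * C₃)
        ≡⟨ right (+ r) S (C₁ * C₁) (C₂ * C₂) (C₃ * C₃) ⟩
      (+ r + S) * (+ r + S) + C₁ * C₁ + C₂ * C₂ + C₃ * C₃ ∎)
      where
      open ≡-Reasoning
      left : ∀ r s m k → r * (r + + 2 * s + m * k) ≡ r * r + + 2 * r * s + k * (m * r)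
      left = solve-∀
      right : ∀ r s a b e → r * r + + 2 * r * s + (s * s + a + b + e) ≡ (r + s) * (r + s) + a + b + e
      right = solve-∀

    -- If r = 0, then all `yᵢ` vanish, so S = 0 and p = m K, which is impossible for a prime p with
    -- 1 < m < p.
    0<r : 0 ℕ.< r
    0<r = ℕ.n≢0⇒n>0 λ r≡0 → prime-no-multiple pp 1<m m<p K (r≡0⇒p≡mK r≡0)
      where
      open ≡-Reasoning
      module _ (r≡0 : r ≡ 0) where
        n≡0 : n ≡ 0
        n≡0 = trans n≡mr (trans (cong (m ℕ.*_) r≡0) (ℕ.*-zeroʳ m))

        root : ∀ y → ∣ y ∣ ℕ.* ∣ y ∣ ≡ 0 → y ≡ + 0
        root y eq = ∣i∣≡0⇒i≡0 (reduce (ℕ.m*n≡0⇒m≡0∨n≡0 ∣ y ∣ eq))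

        n₃≡0 = ℕ.m+n≡0⇒m≡0 _ n≡0
        n₂≡0 = ℕ.m+n≡0⇒m≡0 _ n₃≡0

        S≡0 : S ≡ + 0
        S≡0 = trans
          (cong₂ _+_ (cong₂ _+_ (cong₂ _+_
            (cong (k₁ *_) (root y₁ (ℕ.m+n≡0⇒m≡0 _ n₂≡0)))
            (cong (k₂ *_) (root y₂ (ℕ.m+n≡0⇒n≡0 (∣ y₁ ∣ ℕ.* ∣ y₁ ∣) n₂≡0))))
            (cong (k₃ *_) (root y₃ (ℕ.m+n≡0⇒n≡0 (∣ y₁ ∣ ℕ.* ∣ y₁ ∣ ℕ.+ ∣ y₂ ∣ ℕ.* ∣ y₂ ∣) n₃≡0))))
            (cong (k₄ *_) (root y₄ (ℕ.m+n≡0⇒n≡0 (∣ y₁ ∣ ℕ.* ∣ y₁ ∣ ℕ.+ ∣ y₂ ∣ ℕ.* ∣ y₂ ∣ ℕ.+ ∣ y₃ ∣ ℕ.* ∣ y₃ ∣) n≡0))))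
          (zeros k₁ k₂ k₃ k₄)
          where
          zeros : ∀ a b e f → a * + 0 + b * + 0 + e * + 0 + f * + 0 ≡ + 0
          zeros = solve-∀

        r≡0⇒p≡mK : + p ≡ + m * K
        r≡0⇒p≡mK = trans p≡ (trans (cong₂ (λ a b → + a + + 2 * b + + m * K) r≡0 S≡0) (+-identityˡ _))

    Residue : ℤ → Set
    Residue y = 2 ℕ.* ∣ y ∣ ℕ.< m ⊎ + 2 * y ≡ + m

    residue-≤ : ∀ {y} → Residue y → 2 ℕ.* ∣ y ∣ ℕ.≤ m
    residue-≤ (inj₁ lt) = ℕ.<⇒≤ lt
    residue-≤ {y} (inj₂ eq) = ℕ.≤-reflexive (trans (sym (abs-* (+ 2) y)) (cong ∣_∣ eq))

    -- If r ≥ m, then all the inequalities 2∣yᵢ∣ ≤ m are equalities, and m divides p.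
    r<m : Residue y₁ → Residue y₂ → Residue y₃ → Residue y₄ → r ℕ.< m
    r<m h₁ h₂ h₃ h₄ = go h₁ h₂ h₃ h₄
      where

      n<mm⇒r<m : n ℕ.< m ℕ.* m → r ℕ.< m
      n<mm⇒r<m lt = ℕ.*-cancelˡ-< m r m (subst (ℕ._< m ℕ.* m) n≡mr lt)

      swap₂ : ∀ a b e f → b ℕ.+ a ℕ.+ e ℕ.+ f ≡ a ℕ.+ b ℕ.+ e ℕ.+ f
      swap₂ = ℕSolver.solve-∀
      swap₃ : ∀ a b e f → e ℕ.+ a ℕ.+ b ℕ.+ f ≡ a ℕ.+ b ℕ.+ e ℕ.+ f
      swap₃ = ℕSolver.solve-∀
      swap₄ : ∀ a b e f → f ℕ.+ a ℕ.+ b ℕ.+ e ≡ a ℕ.+ b ℕ.+ e ℕ.+ f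
      swap₄ = ℕSolver.solve-∀

      module _ (e₁ : + 2 * y₁ ≡ + m) (e₂ : + 2 * y₂ ≡ + m) (e₃ : + 2 * y₃ ≡ + m) (e₄ : + 2 * y₄ ≡ + m) where
        T = k₁ + k₂ + k₃ + k₄

        2S≡ : + 2 * S ≡ + m * T
        2S≡ = begin
          + 2 * S ≡⟨ distribute k₁ k₂ k₃ k₄ y₁ y₂ y₃ y₄ ⟩
          k₁ * (+ 2 * y₁) + k₂ * (+ 2 * y₂) + k₃ * (+ 2 * y₃) + k₄ * (+ 2 * y₄)
            ≡⟨ cong₂ _+_ (cong₂ _+_ (cong₂ _+_ (cong (k₁ *_) e₁) (cong (k₂ *_) e₂)) (cong (k₃ *_) e₃)) (cong (k₄ *_) e₄) ⟩
          k₁ * + m + k₂ * + m + k₃ * + m + k₄ * + m ≡⟨ collect k₁ k₂ k₃ k₄ (+ m) ⟩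
          + m * T ∎
          where
          open ≡-Reasoning
          distribute : ∀ k₁ k₂ k₃ k₄ y₁ y₂ y₃ y₄ → + 2 * (k₁ * y₁ + k₂ * y₂ + k₃ * y₃ + k₄ * y₄) ≡
            k₁ * (+ 2 * y₁) + k₂ * (+ 2 * y₂) + k₃ * (+ 2 * y₃) + k₄ * (+ 2 * y₄)
          distribute = solve-∀
          collect : ∀ k₁ k₂ k₃ k₄ m → k₁ * m + k₂ * m + k₃ * m + k₄ * m ≡ m * (k₁ + k₂ + k₃ + k₄)
          collect = solve-∀

        4N≡4mm : + 4 * N ≡ + 4 * (+ m * + m)
        4N≡4mm = begin
          + 4 * N ≡⟨ distribute y₁ y₂ y₃ y₄ ⟩
          (+ 2 * y₁) * (+ 2 * y₁) + (+ 2 * y₂) * (+ 2 * y₂) + (+ 2 * y₃) * (+ 2 * y₃) + (+ 2 * y₄) * (+ 2 * y₄)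
            ≡⟨ cong₂ _+_ (cong₂ _+_ (cong₂ _+_ (cong₂ _*_ e₁ e₁) (cong₂ _*_ e₂ e₂)) (cong₂ _*_ e₃ e₃)) (cong₂ _*_ e₄ e₄) ⟩
          + m * + m + + m * + m + + m * + m + + m * + m ≡⟨ collect (+ m) ⟩
          + 4 * (+ m * + m) ∎
          where
          open ≡-Reasoning
          distribute : ∀ y₁ y₂ y₃ y₄ → + 4 * (y₁ * y₁ + y₂ * y₂ + y₃ * y₃ + y₄ * y₄) ≡
            (+ 2 * y₁) * (+ 2 * y₁) + (+ 2 * y₂) * (+ 2 * y₂) + (+ 2 * y₃) * (+ 2 * y₃) + (+ 2 * y₄) * (+ 2 * y₄)
          distribute = solve-∀
          collect : ∀ m → m * m + m * m + m * m + m * m ≡ + 4 * (m * m)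
          collect = solve-∀

        r≡m : + r ≡ + m
        r≡m = *-cancelˡ-≡ (+ m) (+ r) (+ m)
          (trans (cong (+ m *_) (sym R≡r)) (trans (sym N≡mR) (*-cancelˡ-≡ (+ 4) _ _ 4N≡4mm)))

        -- If 2 yᵢ = m for all i, then N = m² gives r = m, and 2 S = m T. So all three summands of p
        -- in `p≡` are multiples of m.
        all-extreme : + p ≡ + m * (+ 1 + T + K)
        all-extreme = trans p≡ (trans (cong₂ (λ a b → a + b + + m * K) r≡m 2S≡) (collect (+ m) T K))
          where
          collect : ∀ m t k → m + m * t + m * k ≡ m * (+ 1 + t + k)
          collect = solve-∀

      go : Residue y₁ → Residue y₂ → Residue y₃ → Residue y₄ → r ℕ.< m
      go (inj₁ lt) _ _ _ = n<mm⇒r<m (sumOfSquares<m² m (∣ y₁ ∣) (∣ y₂ ∣) (∣ y₃ ∣) (∣ y₄ ∣) lt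
        (residue-≤ h₂) (residue-≤ h₃) (residue-≤ h₄))
      go _ (inj₁ lt) _ _ = n<mm⇒r<m (subst (ℕ._< m ℕ.* m)
        (swap₂ (∣ y₁ ∣ ℕ.* ∣ y₁ ∣) (∣ y₂ ∣ ℕ.* ∣ y₂ ∣) (∣ y₃ ∣ ℕ.* ∣ y₃ ∣) (∣ y₄ ∣ ℕ.* ∣ y₄ ∣))
        (sumOfSquares<m² m (∣ y₂ ∣) (∣ y₁ ∣) (∣ y₃ ∣) (∣ y₄ ∣) lt (residue-≤ h₁) (residue-≤ h₃) (residue-≤ h₄)))
      go _ _ (inj₁ lt) _ = n<mm⇒r<m (subst (ℕ._< m ℕ.* m)
        (swap₃ (∣ y₁ ∣ ℕ.* ∣ y₁ ∣) (∣ y₂ ∣ ℕ.* ∣ y₂ ∣) (∣ y₃ ∣ ℕ.* ∣ y₃ ∣) (∣ y₄ ∣ ℕ.* ∣ y₄ ∣))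
        (sumOfSquares<m² m (∣ y₃ ∣) (∣ y₁ ∣) (∣ y₂ ∣) (∣ y₄ ∣) lt (residue-≤ h₁) (residue-≤ h₂) (residue-≤ h₄)))
      go _ _ _ (inj₁ lt) = n<mm⇒r<m (subst (ℕ._< m ℕ.* m)
        (swap₄ (∣ y₁ ∣ ℕ.* ∣ y₁ ∣) (∣ y₂ ∣ ℕ.* ∣ y₂ ∣) (∣ y₃ ∣ ℕ.* ∣ y₃ ∣) (∣ y₄ ∣ ℕ.* ∣ y₄ ∣))
        (sumOfSquares<m² m (∣ y₄ ∣) (∣ y₁ ∣) (∣ y₂ ∣) (∣ y₃ ∣) lt (residue-≤ h₁) (residue-≤ h₂) (residue-≤ h₃)))
      go (inj₂ e₁) (inj₂ e₂) (inj₂ e₃) (inj₂ e₄) =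
        ⊥-elim (prime-no-multiple pp 1<m m<p _ (all-extreme e₁ e₂ e₃ e₄))

  descent : ∀ {p m} .{{_ : NonZero m}} → Prime p → 1 ℕ.< m → m ℕ.< p → FourSquares (+ m * + p) →
    ∃[ r ] 0 ℕ.< r × r ℕ.< m × FourSquares (+ r * + p)
  descent {p} {m} pp 1<m m<p (x₁ , x₂ , x₃ , x₄ , mp≡)
    with centredResidue m x₁ | centredResidue m x₂ | centredResidue m x₃ | centredResidue m x₄
  ... | y₁ , k₁ , e₁ , h₁ | y₂ , k₂ , e₂ , h₂ | y₃ , k₃ , e₃ , h₃ | y₄ , k₄ , e₄ , h₄ =
    r , 0<r , r<m h₁ h₂ h₃ h₄ , fourSquares-r*p
    where
    square-cong : ∀ {x y} → x ≡ y → x * x ≡ y * y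
    square-cong = cong (λ t → t * t)
    open Descent p m pp 1<m m<p y₁ y₂ y₃ y₄ k₁ k₂ k₃ k₄
      (trans mp≡ (cong₂ _+_ (cong₂ _+_ (cong₂ _+_ (square-cong e₁) (square-cong e₂))
        (square-cong e₃)) (square-cong e₄)))

  ≡-mod⇒∣difference : ∀ x y n .{{_ : NonZero n}} → x %ℕ n ≡ y %ℕ n → ∃[ k ] x - y ≡ k * + n
  ≡-mod⇒∣difference x y n eq = x /ℕ n - y /ℕ n , (begin
    x - y ≡⟨ cong₂ _-_ (a≡a%ℕn+[a/ℕn]*n x n) (trans (a≡a%ℕn+[a/ℕn]*n y n) (cong (λ t → + t + y /ℕ n * + n) (sym eq))) ⟩
    + (x %ℕ n) + x /ℕ n * + n - (+ (x %ℕ n) + y /ℕ n * + n) ≡⟨ subtract (+ (x %ℕ n)) (x /ℕ n) (y /ℕ n) (+ n) ⟩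
    (x /ℕ n - y /ℕ n) * + n ∎)
    where
    open ≡-Reasoning
    subtract : ∀ r a b n → r + a * n - (r + b * n) ≡ (a - b) * n
    subtract = solve-∀

  -- A small multiple of p of the form 1 + a² + b²

  module SmallMultiple (p : ℕ) (pp : Prime p) where

    instance
      p≢0 : NonZero p
      p≢0 = prime⇒nonZero pp

    1<p : 1 ℕ.< p
    1<p = ℕ.nonTrivial⇒n>1 p {{prime⇒nonTrivial pp}}

    h : ℕ
    h = p ℕ./ 2

    h*2≤p : h ℕ.* 2 ℕ.≤ p
    h*2≤p = ℕ.m/n*n≤m p 2

    -- The count for the pigeonhole principle: the two families of h + 1 values outnumber the p
    -- residues, also for p = 2.
    p<1+h+1+h : p ℕ.< suc h ℕ.+ suc h
    p<1+h+1+h = subst₂ ℕ._<_ (sym (ℕ.m≡m%n+[m/n]*n p 2)) (double h) (ℕ.+-monoˡ-< (h ℕ.* 2) (ℕ.m%n<n p 2))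
      where
      double : ∀ h → 2 ℕ.+ h ℕ.* 2 ≡ suc h ℕ.+ suc h
      double = ℕSolver.solve-∀

    2a≤p : (a : Fin (suc h)) → 2 ℕ.* Fin.toℕ a ℕ.≤ p
    2a≤p a = ℕ.≤-trans (ℕ.*-monoʳ-≤ 2 (Fin.toℕ≤pred[n] a)) (subst (ℕ._≤ p) (ℕ.*-comm h 2) h*2≤p)

    -- In b² - a² = (b - a)(b + a) both factors are positive and smaller than p, since a < b and 2b
    -- ≤ p. A prime p dividing the product would divide one of them.
    squares-distinct : ∀ {a b} → a ℕ.< b → 2 ℕ.* b ℕ.≤ p → ∀ k → + b * + b - + a * + a ≢ k * + p
    squares-distinct {a} {b} a<b 2b≤p k eq = [ p∤d , p∤b+a ]′ (euclidsLemma d (b ℕ.+ a) pp (ℕ.divides ∣ k ∣ d*[b+a]≡))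
      where
      d = b ℕ.∸ a

      instance
        d≢0 : NonZero d
        d≢0 = ℕ.>-nonZero (ℕ.m<n⇒0<n∸m a<b)
        b+a≢0 : NonZero (b ℕ.+ a)
        b+a≢0 = ℕ.>-nonZero (ℕ.<-≤-trans (ℕ.≤-<-trans ℕ.z≤n a<b) (ℕ.m≤m+n b a))

      difference : ∀ a d → d * (a + d + a) ≡ (a + d) * (a + d) - a * a
      difference = solve-∀

      a+d≡b : a ℕ.+ d ≡ b
      a+d≡b = ℕ.m+[n∸m]≡n (ℕ.<⇒≤ a<b)

      d*[b+a]≡ : d ℕ.* (b ℕ.+ a) ≡ ∣ k ∣ ℕ.* p
      d*[b+a]≡ = begin
        d ℕ.* (b ℕ.+ a)              ≡⟨ abs-* (+ d) (+ (b ℕ.+ a)) ⟨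
        ∣ + d * + (b ℕ.+ a) ∣
          ≡⟨ cong ∣_∣ (subst (λ t → + d * + (t ℕ.+ a) ≡ + t * + t - + a * + a) a+d≡b (difference (+ a) (+ d))) ⟩
        ∣ + b * + b - + a * + a ∣    ≡⟨ cong ∣_∣ eq ⟩
        ∣ k * + p ∣                  ≡⟨ abs-* k (+ p) ⟩
        ∣ k ∣ ℕ.* p                  ∎
        where open ≡-Reasoning

      b+a<p : b ℕ.+ a ℕ.< p
      b+a<p = ℕ.<-≤-trans (ℕ.+-monoʳ-< b a<b) (subst (λ t → b ℕ.+ t ℕ.≤ p) (ℕ.+-identityʳ b) 2b≤p)

      p∤b+a : ¬ (p ℕ.∣ b ℕ.+ a)
      p∤b+a p∣ = ℕ.<⇒≱ b+a<p (ℕ.∣⇒≤ p∣)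

      p∤d : ¬ (p ℕ.∣ d)
      p∤d p∣ = ℕ.<⇒≱ (ℕ.≤-<-trans (ℕ.≤-trans (ℕ.m∸n≤m b a) (ℕ.m≤m+n b a)) b+a<p) (ℕ.∣⇒≤ p∣)

    squares-injective : ∀ (a b : Fin (suc h)) k →
      + Fin.toℕ a * + Fin.toℕ a - + Fin.toℕ b * + Fin.toℕ b ≡ k * + p → a ≡ b
    squares-injective a b k eq with ℕ.<-cmp (Fin.toℕ a) (Fin.toℕ b)
    ... | tri≈ _ a≡b _ = Fin.toℕ-injective a≡b
    ... | tri> _ _ b<a = ⊥-elim (squares-distinct b<a (2a≤p a) k eq)
    ... | tri< a<b _ _ = ⊥-elim (squares-distinct a<b (2a≤p b) (- k)
      (trans (swap (+ Fin.toℕ a * + Fin.toℕ a) (+ Fin.toℕ b * + Fin.toℕ b))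
        (trans (cong -_ eq) (neg-distribˡ-* k (+ p)))))
      where
      swap : ∀ s t → t - s ≡ - (s - t)
      swap = solve-∀

    value : Fin (suc h) ⊎ Fin (suc h) → ℤ
    value (inj₁ a) = + Fin.toℕ a * + Fin.toℕ a
    value (inj₂ b) = - (+ 1 + + Fin.toℕ b * + Fin.toℕ b)

    Result : Set
    Result = ∃[ m ] 0 ℕ.< m × m ℕ.< p × FourSquares (+ m * + p)

    opposite : ∀ (a b : Fin (suc h)) k →
      + 1 + + Fin.toℕ a * + Fin.toℕ a + + Fin.toℕ b * + Fin.toℕ b ≡ k * + p → Result
    opposite i j k eq = ∣ k ∣ , ℕ.n≢0⇒n>0 ∣k∣≢0 , ∣k∣<p ,
      (+ 0 , + 1 , + a , + b , (begin
        + ∣ k ∣ * + p                            ≡⟨ pos-* ∣ k ∣ p ⟨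
        + (∣ k ∣ ℕ.* p)                          ≡⟨ cong +_ abs≡ ⟨
        + (1 ℕ.+ a ℕ.* a ℕ.+ b ℕ.* b)            ≡⟨ cong₂ (λ s t → + 1 + s + t) (pos-* a a) (pos-* b b) ⟩
        + 1 + + a * + a + + b * + b              ∎))
      where
      open ≡-Reasoning
      a = Fin.toℕ i
      b = Fin.toℕ j

      abs≡ : 1 ℕ.+ a ℕ.* a ℕ.+ b ℕ.* b ≡ ∣ k ∣ ℕ.* p
      abs≡ = trans (cong ∣_∣ (trans (cong₂ (λ s t → + 1 + s + t) (pos-* a a) (pos-* b b)) eq)) (abs-* k (+ p))

      ∣k∣≢0 : ∣ k ∣ ≢ 0
      ∣k∣≢0 e with () ← trans abs≡ (cong (ℕ._* p) e)

      ∣k∣<p : ∣ k ∣ ℕ.< p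
      -- The strict bound is the one for the summand 0². The summand 1² then needs only 2 ≤ p, so p
      -- = 2 is covered.
      ∣k∣<p = ℕ.*-cancelʳ-< _ _ p (subst (ℕ._< p ℕ.* p) abs≡
        (sumOfSquares<m² p 0 1 a b (ℕ.<-trans (ℕ.s≤s ℕ.z≤n) 1<p) 1<p (2a≤p i) (2a≤p j)))

    -- Among the h + 1 residues a² and the h + 1 residues -1 - b² with 0 ≤ a, b ≤ h = ⌊p/2⌋, two coincide.
    collision : ∀ u v → u ≢ v → ∀ k → value u - value v ≡ k * + p → Result
    collision (inj₁ a) (inj₁ b) u≢v k eq = ⊥-elim (u≢v (cong inj₁ (squares-injective a b k eq)))
    collision (inj₂ a) (inj₂ b) u≢v k eq = ⊥-elim (u≢v (cong inj₂ (sym (squares-injective b a k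
      (trans (cancel (+ Fin.toℕ a * + Fin.toℕ a) (+ Fin.toℕ b * + Fin.toℕ b)) eq)))))
      where
      cancel : ∀ s t → t - s ≡ - (+ 1 + s) - - (+ 1 + t)
      cancel = solve-∀
    collision (inj₁ a) (inj₂ b) u≢v k eq = opposite a b k
      (trans (move (+ Fin.toℕ a * + Fin.toℕ a) (+ Fin.toℕ b * + Fin.toℕ b)) eq)
      where
      move : ∀ s t → + 1 + s + t ≡ s - - (+ 1 + t)
      move = solve-∀
    collision (inj₂ a) (inj₁ b) u≢v k eq = opposite b a (- k)
      (trans (move (+ Fin.toℕ a * + Fin.toℕ a) (+ Fin.toℕ b * + Fin.toℕ b))
        (trans (cong -_ eq) (neg-distribˡ-* k (+ p))))
      where
      move : ∀ s t → + 1 + t + s ≡ - (- (+ 1 + s) - t)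
      move = solve-∀

    residue : Fin (suc h ℕ.+ suc h) → Fin p
    residue i = Fin.fromℕ< (n%ℕd<d (value (Fin.splitAt (suc h) i)) p)

    smallMultiple : Result
    smallMultiple with Fin.pigeonhole p<1+h+1+h residue
    ... | i , j , i<j , eq =
      collision (Fin.splitAt (suc h) i) (Fin.splitAt (suc h) j) split≢ k k≡
      where
      split≢ : Fin.splitAt (suc h) i ≢ Fin.splitAt (suc h) j
      split≢ e = Fin.<⇒≢ i<j (trans (sym (Fin.join-splitAt (suc h) (suc h) i))
        (trans (cong (Fin.join (suc h) (suc h)) e) (Fin.join-splitAt (suc h) (suc h) j)))

      residues≡ = trans (sym (Fin.toℕ-fromℕ< _)) (trans (cong Fin.toℕ eq) (Fin.toℕ-fromℕ< _))
      difference = ≡-mod⇒∣difference (value (Fin.splitAt (suc h) i)) (value (Fin.splitAt (suc h) j)) p residues≡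
      k = proj₁ difference
      k≡ = proj₂ difference

  -- Strong induction on the multiplier, with p fixed: it starts below p by `smallMultiple` and
  -- decreases by `descent` until it is 1.
  fourSquares-prime : ∀ {p} → Prime p → FourSquares (+ p)
  fourSquares-prime {p} pp =
    let m , 0<m , m<p , sq = SmallMultiple.smallMultiple p pp in ℕ.<-rec P step m 0<m m<p sq
    where
    P : ℕ → Set
    P m = 0 ℕ.< m → m ℕ.< p → FourSquares (+ m * + p) → FourSquares (+ p)

    step : ∀ m → (∀ {r} → r ℕ.< m → P r) → P m
    step 1 _ _ _ sq = subst FourSquares (*-identityˡ (+ p)) sq
    step m@(suc (suc _)) rec _ m<p sq =
      let r , 0<r , r<m , sq′ = descent pp (ℕ.s≤s (ℕ.s≤s ℕ.z≤n)) m<p sq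
      in rec r<m 0<r (ℕ.<-trans r<m m<p) sq′

  lagrange : ∀ n → FourSquares (+ n)
  lagrange zero = + 0 , + 0 , + 0 , + 0 , refl
  lagrange n@(suc _) = subst (FourSquares ∘ +_) (sym isFactorisation) (go factorsPrime)
    where
    open PrimeFactorisation (factorise n)
    go : ∀ {ps} → All Prime ps → FourSquares (+ product ps)
    go [] = + 1 , + 0 , + 0 , + 0 , refl
    go {p ∷ ps} (pp ∷ pps) = subst FourSquares (sym (pos-* p (product ps)))
      (fourSquares-* (fourSquares-prime pp) (go pps))

-- Divisibility, primes and p-parts in ℤ

module IntegerArithmetic where
  open import Data.Integer hiding (suc; _⊔_)
  import Data.Integer.Divisibility.Signed as ℤ
  open import Data.Integer.DivMod using (_%_; _/_; n%d<d; a≡a%n+[a/n]*n)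
  open import Data.Integer.Properties
  open import Data.Integer.Tactic.RingSolver using (solve-∀)
  open import Data.List using ([]; _∷_)
  open import Data.List.Relation.Unary.All using (All; []; _∷_)
  import Data.Nat.Divisibility as ℕ
  import Data.Nat.Induction as ℕ
  open import Data.Nat.ListAction using (product)
  open import Data.Nat.Primality using (Prime; ¬prime[0]; ¬prime[1]; prime⇒irreducible)
  open import Data.Nat.Primality.Factorisation using (PrimeFactorisation; factorise)
  open import Relation.Binary.PropositionalEquality
  open import Relation.Nullary using (Dec; _⊎-dec_)
  open LagrangeFourSquares using (fourSquares-*; lagrange; norm≡+)

  open Divisibility ℤ.+-*-rawRing ℤ id

  ∣i∣≡1⇒unit : ∀ {i} → ∣ i ∣ ≡ 1 → Unit i
  ∣i∣≡1⇒unit {+ 1}      refl = inj₁ refl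
  ∣i∣≡1⇒unit { -[1+ 0 ]} refl = inj₂ refl

  unit⇒∣i∣≡1 : ∀ {i} → Unit i → ∣ i ∣ ≡ 1
  unit⇒∣i∣≡1 = [ cong ∣_∣ , cong ∣_∣ ]′

  factor-of-1⇒unit : ∀ u w → u * w ≡ + 1 → Unit w
  factor-of-1⇒unit u w eq = ∣i∣≡1⇒unit (ℕ.m*n≡1⇒n≡1 ∣ u ∣ ∣ w ∣ (trans (sym (abs-* u w)) (cong ∣_∣ eq)))

  ∣i∣≡n⇒i≡±n : ∀ i → i ≡ + ∣ i ∣ ⊎ i ≡ - + ∣ i ∣
  ∣i∣≡n⇒i≡±n (+ n)    = inj₁ refl
  ∣i∣≡n⇒i≡±n -[1+ n ] = inj₂ refl

  *-nonzeroˡ : ∀ i j → i * j ≢ + 0 → i ≢ + 0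
  *-nonzeroˡ i j ij≢0 refl = ij≢0 refl

  *-nonzeroʳ : ∀ i j → i * j ≢ + 0 → j ≢ + 0
  *-nonzeroʳ i j ij≢0 refl = ij≢0 (*-zeroʳ i)

  *-nonzero : ∀ {i j} → i ≢ + 0 → j ≢ + 0 → i * j ≢ + 0
  *-nonzero {i} i≢0 j≢0 ij≡0 = [ i≢0 , j≢0 ]′ (i*j≡0⇒i≡0∨j≡0 i ij≡0)

  -- The linear relation is imposed on the cofactors rather than on g, so that the cofactors are
  -- coprime even when x = y = 0. The base case of the algorithm accordingly returns g = x with
  -- cofactors 1 and 0.
  Bezout : ℤ → ℤ → Set
  Bezout x y = ∃[ g ] ∃[ x′ ] ∃[ y′ ] ∃[ u ] ∃[ v ] x ≡ g * x′ × y ≡ g * y′ × u * x′ + v * y′ ≡ + 1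

  bezout : ∀ x y → Bezout x y
  bezout x y = ℕ.<-rec (λ n → ∀ x y → ∣ y ∣ ≡ n → Bezout x y) step ∣ y ∣ x y refl
    where
    euclidean : ∀ x y .{{_ : NonZero y}} → Bezout y (+ (x % y)) → Bezout x y
    euclidean x y (g , y₁ , r₁ , u , v , y≡ , r≡ , eq) =
      g , q * y₁ + r₁ , y₁ , v , u - v * q ,
      trans (a≡a%n+[a/n]*n x y) (trans (cong₂ (λ s t → s + q * t) r≡ y≡) (factor g q y₁ r₁)) ,
      y≡ , trans (combine q y₁ r₁ u v) eq
      where
      q = x / y
      factor : ∀ g q y₁ r₁ → g * r₁ + q * (g * y₁) ≡ g * (q * y₁ + r₁)
      factor = solve-∀
      combine : ∀ q y₁ r₁ u v → v * (q * y₁ + r₁) + (u - v * q) * y₁ ≡ u * y₁ + v * r₁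
      combine = solve-∀

    step : ∀ n → (∀ {m} → m ℕ.< n → ∀ x y → ∣ y ∣ ≡ m → Bezout x y) → ∀ x y → ∣ y ∣ ≡ n → Bezout x y
    step _ rec x (+ 0) refl = x , + 1 , + 0 , + 1 , + 0 , sym (*-identityʳ x) , sym (*-zeroʳ x) , refl
    step _ rec x y@(+[1+ _ ]) refl = euclidean x y (rec (n%d<d x y) y _ refl)
    step _ rec x y@(-[1+ _ ]) refl = euclidean x y (rec (n%d<d x y) y _ refl)

  -- A common divisor of the cofactors divides u x′ + v y′ = 1.
  coprime-cofactors : ∀ x y → ∃[ g ] ∃[ x′ ] ∃[ y′ ] x ≡ g * x′ × y ≡ g * y′ ×
    (∀ d → Multiple d x′ → Multiple d y′ → Unit d)
  coprime-cofactors x y with bezout x y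
  ... | g , x′ , y′ , u , v , x≡ , y≡ , eq = g , x′ , y′ , x≡ , y≡ ,
    λ { d (k , refl) (j , refl) → factor-of-1⇒unit (u * k + v * j) d (trans (factor u k v j d) eq) }
    where
    factor : ∀ u k v j d → (u * k + v * j) * d ≡ u * (k * d) + v * (j * d)
    factor = solve-∀

  prime⇒Irreducible : ∀ {p} → Prime p → Irreducible (+ p)
  prime⇒Irreducible {p} pp =
    (λ p≡0 → ¬prime[0] (subst Prime (cong ∣_∣ p≡0) pp)) ,
    (λ p-unit → ¬prime[1] (subst Prime (unit⇒∣i∣≡1 p-unit) pp)) ,
    λ a b p≡ba → [ (λ a≡1 → Sum.map₂ inj₁ (∣i∣≡1⇒unit a≡1)) , (λ a≡p → inj₂ (inj₂ (Sum.map
        (λ e → trans e (cong +_ a≡p)) (λ e → trans e (cong (-_ ∘ +_) a≡p)) (∣i∣≡n⇒i≡±n a)))) ]′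
      (prime⇒irreducible pp (ℕ.divides ∣ b ∣ (trans (cong ∣_∣ p≡ba) (abs-* b a))))

  prime-factor : ∀ x → x ≢ + 0 → ¬ Unit x → ∃[ p ] Irreducible p × FourSquares p × Multiple p x
  prime-factor x x≢0 x-nonunit = from-factors factorsPrime isFactorisation
    where
    open PrimeFactorisation (factorise ∣ x ∣ {{ℕ.≢-nonZero (x≢0 ∘ ∣i∣≡0⇒i≡0)}})

    from-factors : ∀ {ps} → All Prime ps → ∣ x ∣ ≡ product ps → ∃[ p ] Irreducible p × FourSquares p × Multiple p x
    from-factors [] ∣x∣≡1 = ⊥-elim (x-nonunit (∣i∣≡1⇒unit ∣x∣≡1))
    from-factors {p ∷ ps} (pp ∷ _) ∣x∣≡p*t = + p , prime⇒Irreducible pp , lagrange p ,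
      [ (λ e → + t , trans e (trans (cong +_ ∣x∣≡p*t) (trans (pos-* p t) (*-comm (+ p) (+ t)))))
      , (λ e → - + t , trans e (trans (cong (-_ ∘ +_) ∣x∣≡p*t)
          (trans (cong -_ (trans (pos-* p t) (*-comm (+ p) (+ t)))) (neg-distribˡ-* (+ t) (+ p)))))
      ]′ (∣i∣≡n⇒i≡±n x)
      where
      t = product ps

  -- The common divisor g of p and a is a divisor of p, hence a unit or ± p. If g = ± p, then p
  -- divides a. If g = ± 1, multiplying u p′ + v a′ = 1 by b writes b as a combination of p and a b.
  euclid : ∀ p → Irreducible p → ∀ a b → Multiple p (a * b) → Multiple p a ⊎ Multiple p b
  euclid p (_ , _ , irr) a b (k , ab≡kp) with bezout p a
  ... | g , p′ , a′ , u , v , p≡ , a≡ , eq with irr g p′ (trans p≡ (*-comm g p′))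
  ... | inj₂ (inj₂ (inj₁ refl)) = inj₁ (a′ , trans a≡ (*-comm p a′))
  ... | inj₂ (inj₂ (inj₂ refl)) = inj₁ (- a′ , trans a≡ (swap p a′))
    where
    swap : ∀ p a′ → - p * a′ ≡ - a′ * p
    swap = solve-∀
  ... | inj₁ refl = inj₂ (u * b + v * k , (begin
    b                           ≡⟨ *-identityʳ b ⟨
    b * + 1                     ≡⟨ cong (b *_) eq ⟨
    b * (u * p′ + v * a′)       ≡⟨ expand b u p′ v a′ ⟩
    u * b * (+ 1 * p′) + v * (+ 1 * a′ * b) ≡⟨ cong₂ (λ s t → u * b * s + v * (t * b)) p≡ a≡ ⟨
    u * b * p + v * (a * b)     ≡⟨ cong (λ t → u * b * p + v * t) ab≡kp ⟩
    u * b * p + v * (k * p)     ≡⟨ collect u b v k p ⟩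
    (u * b + v * k) * p         ∎))
    where
    open ≡-Reasoning
    expand : ∀ b u p′ v a′ → b * (u * p′ + v * a′) ≡ u * b * (+ 1 * p′) + v * (+ 1 * a′ * b)
    expand = solve-∀
    collect : ∀ u b v k p → u * b * p + v * (k * p) ≡ (u * b + v * k) * p
    collect = solve-∀
  ... | inj₂ (inj₁ refl) = inj₂ (- (u * b + v * k) , (begin
    b                           ≡⟨ *-identityʳ b ⟨
    b * + 1                     ≡⟨ cong (b *_) eq ⟨
    b * (u * p′ + v * a′)       ≡⟨ expand b u p′ v a′ ⟩
    - (u * b * (-[1+ 0 ] * p′) + v * (-[1+ 0 ] * a′ * b)) ≡⟨ cong₂ (λ s t → - (u * b * s + v * (t * b))) p≡ a≡ ⟨
    - (u * b * p + v * (a * b)) ≡⟨ cong (λ t → - (u * b * p + v * t)) ab≡kp ⟩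
    - (u * b * p + v * (k * p)) ≡⟨ collect u b v k p ⟩
    - (u * b + v * k) * p       ∎))
    where
    open ≡-Reasoning
    expand : ∀ b u p′ v a′ → b * (u * p′ + v * a′) ≡ - (u * b * (-[1+ 0 ] * p′) + v * (-[1+ 0 ] * a′ * b))
    expand = solve-∀
    collect : ∀ u b v k p → - (u * b * p + v * (k * p)) ≡ - (u * b + v * k) * p
    collect = solve-∀

  multiple-trans : ∀ {p q x} → Multiple p q → Multiple q x → Multiple p x
  multiple-trans {p} (k , refl) (j , refl) = j * k , sym (*-assoc j k p)

  fourSquares-total : ∀ x → FourSquares x ⊎ FourSquares (- x)
  fourSquares-total (+ n)    = inj₁ (lagrange n)
  fourSquares-total -[1+ n ] = inj₂ (lagrange (ℕ.suc n))

  fourSquares-antisym : ∀ x → FourSquares x → FourSquares (- x) → x ≡ + 0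
  fourSquares-antisym -[1+ n ] (a , b , e , f , x≡) _ with () ← trans x≡ (norm≡+ a b e f)
  fourSquares-antisym (+ 0) _ _ = refl
  fourSquares-antisym +[1+ n ] _ (a , b , e , f , x≡) with () ← trans x≡ (norm≡+ a b e f)

  -- Otherwise - w is a sum of four squares, hence so is - (w y), and antisymmetry forces w y = 0.
  fourSquares-cofactor : ∀ w y → y ≢ + 0 → FourSquares y → FourSquares (w * y) → FourSquares w
  fourSquares-cofactor w y y≢0 y-fs wy-fs with fourSquares-total w
  ... | inj₁ w-fs = w-fs
  ... | inj₂ -w-fs with i*j≡0⇒i≡0∨j≡0 w (fourSquares-antisym (w * y) wy-fs
    (subst FourSquares (sym (neg-distribˡ-* w y)) (fourSquares-* -w-fs y-fs)))
  ... | inj₁ refl = lagrange 0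
  ... | inj₂ y≡0 = ⊥-elim (y≢0 y≡0)

  power-1 : ∀ p → Power p (+ 1)
  power-1 p = (λ ()) , lagrange 1 , λ w u 1≡uw → inj₁ (factor-of-1⇒unit u w (sym 1≡uw))

  power-self : ∀ p → Irreducible p → FourSquares p → Power p p
  power-self p (p≢0 , _ , irr) p-fs = p≢0 , p-fs , λ w u p≡uw → divisor w (irr w u p≡uw)
    where
    divisor : ∀ w → w ≡ + 1 ⊎ w ≡ - + 1 ⊎ w ≡ p ⊎ w ≡ - p → Unit w ⊎ Multiple p w
    divisor w (inj₁ e) = inj₁ (inj₁ e)
    divisor w (inj₂ (inj₁ e)) = inj₁ (inj₂ e)
    divisor w (inj₂ (inj₂ (inj₁ e))) = inj₂ (+ 1 , trans e (sym (*-identityˡ p)))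
    divisor w (inj₂ (inj₂ (inj₂ e))) = inj₂ (- + 1 , trans e (sym (-1*i≡-i p)))

  unit? : ∀ x → Dec (Unit x)
  unit? x = (x ≟ + 1) ⊎-dec (x ≟ - + 1)

  -- A nonunit divisor w of x y has a prime factor q, which divides x or y by Euclid's lemma. As a
  -- nonunit divisor of a power of p, q is a multiple of p, and therefore so is w.
  power-* : ∀ p x y → Power p x → Power p y → Power p (x * y)
  power-* p x y (x≢0 , x-fs , x-pow) (y≢0 , y-fs , y-pow) =
    *-nonzero x≢0 y≢0 , fourSquares-* x-fs y-fs , divisor
    where
    divisor : ∀ w u → x * y ≡ u * w → Unit w ⊎ Multiple p w
    divisor w u eq with unit? w
    ... | yes w-unit = inj₁ w-unit
    ... | no w-nonunit with prime-factor w (*-nonzeroʳ u w (subst (_≢ + 0) eq (*-nonzero x≢0 y≢0))) w-nonunit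
    ... | q , q-irr@(_ , q-nonunit , _) , _ , q∣w@(k , w≡kq) =
      inj₂ (multiple-trans ([ p∣q x-pow , p∣q y-pow ]′ (euclid q q-irr x y (u * k , xy≡))) q∣w)
      where
      xy≡ : x * y ≡ u * k * q
      xy≡ = trans eq (trans (cong (u *_) w≡kq) (sym (*-assoc u k q)))
      p∣q : ∀ {z} → (∀ w u → z ≡ u * w → Unit w ⊎ Multiple p w) → Multiple q z → Multiple p q
      p∣q z-pow (j , z≡jq) = [ ⊥-elim ∘ q-nonunit , id ]′ (z-pow q j z≡jq)

  power-cofactor : ∀ p x y g → x ≡ y * g → Power p x → FourSquares g → Power p y
  power-cofactor p x y g refl (x≢0 , x-fs , x-pow) g-fs = *-nonzeroˡ y g x≢0 ,
    fourSquares-cofactor y g (*-nonzeroʳ y g x≢0) g-fs x-fs ,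
    λ { w u refl → x-pow w (u * g) (reorder u w g) }
    where
    reorder : ∀ u w g → u * w * g ≡ u * g * w
    reorder = solve-∀

  -- A unit of ℤ is its own inverse.
  unit-*-unit : ∀ {e} → Unit e → ∀ x y → x ≡ y * e → y ≡ x * e
  unit-*-unit (inj₁ refl) x y refl = cancel y
    where
    cancel : ∀ y → y ≡ y * + 1 * + 1
    cancel = solve-∀
  unit-*-unit (inj₂ refl) x y refl = cancel y
    where
    cancel : ∀ y → y ≡ y * -[1+ 0 ] * -[1+ 0 ]
    cancel = solve-∀

  -- This takes the place of comparing exponents. Write x = g x′ and y = g y′ with coprime
  -- cofactors. Each cofactor divides a power of p, so it is a unit or a multiple of p, and both
  -- cannot be multiples of p. The number whose cofactor is a unit divides the other.
  power-compare : ∀ p → Irreducible p → ∀ x y → Power p x → Power p y →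
    ∃[ w ] Power p w × (x ≡ w * y ⊎ y ≡ w * x)
  power-compare p (_ , p-nonunit , _) x y x-pow y-pow with coprime-cofactors x y
  ... | g , x′ , y′ , x≡ , y≡ , coprime
    with proj₂ (proj₂ x-pow) x′ g x≡ | proj₂ (proj₂ y-pow) y′ g y≡
  ... | inj₂ p∣x′ | inj₂ p∣y′ = ⊥-elim (p-nonunit (coprime p p∣x′ p∣y′))
  ... | inj₁ x′-unit | _ = y′ * x′ ,
    power-cofactor p y (y′ * x′) x [y′x′]x y-pow (proj₁ (proj₂ x-pow)) , inj₂ [y′x′]x
    where
    reorder : ∀ x x′ y′ → x * x′ * y′ ≡ y′ * x′ * x
    reorder = solve-∀
    [y′x′]x : y ≡ y′ * x′ * x
    [y′x′]x = trans y≡ (trans (cong (_* y′) (unit-*-unit x′-unit x g x≡)) (reorder x x′ y′))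
  ... | _ | inj₁ y′-unit = x′ * y′ ,
    power-cofactor p x (x′ * y′) y [x′y′]y x-pow (proj₁ (proj₂ y-pow)) , inj₁ [x′y′]y
    where
    reorder : ∀ y y′ x′ → y * y′ * x′ ≡ x′ * y′ * y
    reorder = solve-∀
    [x′y′]y : x ≡ x′ * y′ * y
    [x′y′]y = trans x≡ (trans (cong (_* x′) (unit-*-unit y′-unit y g y≡)) (reorder y y′ x′))

  -- Dividing by p as long as possible lowers the absolute value, because p is neither 0 nor a unit.
  -- This recursion takes place in ℤ only; its outcome is what can be transferred.
  exact-exists : ∀ p → Irreducible p → FourSquares p → ∀ x → x ≢ + 0 → ∃[ y ] Power p y × ExactCofactor p x y
  exact-exists p p-irr@(p≢0 , p-nonunit , _) p-fs x x≢0 =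
    ℕ.<-rec (λ n → ∀ x → ∣ x ∣ ≡ n → x ≢ + 0 → ∃[ y ] Power p y × ExactCofactor p x y) step ∣ x ∣ x refl x≢0
    where
    1<∣p∣ : 1 ℕ.< ∣ p ∣
    1<∣p∣ = ℕ.≤∧≢⇒< (ℕ.n≢0⇒n>0 (p≢0 ∘ ∣i∣≡0⇒i≡0)) (p-nonunit ∘ ∣i∣≡1⇒unit ∘ sym)

    step : ∀ n → (∀ {m} → m ℕ.< n → ∀ x → ∣ x ∣ ≡ m → x ≢ + 0 → ∃[ y ] Power p y × ExactCofactor p x y) →
      ∀ x → ∣ x ∣ ≡ n → x ≢ + 0 → ∃[ y ] Power p y × ExactCofactor p x y
    step n rec x refl x≢0 with p ℤ.∣? x
    ... | no p∤x = + 1 , power-1 p , x , sym (*-identityʳ x) , λ (k , x≡kp) → p∤x (ℤ.divides k x≡kp)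
    ... | yes (ℤ.divides x′ x≡x′p) =
      let x′≢0 = *-nonzeroˡ x′ p (subst (_≢ + 0) x≡x′p x≢0)
          y , y-pow , z , x′≡zy , p∤z = rec (smaller x′≢0) x′ refl x′≢0
      in y * p , power-* p y p y-pow (power-self p p-irr p-fs) , z ,
         trans x≡x′p (trans (cong (_* p) x′≡zy) (*-assoc z y p)) , p∤z
      where
      smaller : x′ ≢ + 0 → ∣ x′ ∣ ℕ.< ∣ x ∣
      smaller x′≢0 = subst (∣ x′ ∣ ℕ.<_) (sym (trans (cong ∣_∣ x≡x′p) (abs-* x′ p)))
        (ℕ.m<m*n ∣ x′ ∣ ∣ p ∣ {{ℕ.≢-nonZero (x′≢0 ∘ ∣i∣≡0⇒i≡0)}} 1<∣p∣)

  -- By comparability one of y, y′ is w times the other; then w divides the cofactor of the other,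
  -- so p ∤ w and the power w is a unit, which is 1 since both y and y′ are sums of squares.
  exact-unique : ∀ p → Irreducible p → ∀ x y y′ → Power p y → Power p y′ →
    ExactCofactor p x y → ExactCofactor p x y′ → y ≡ y′
  exact-unique p p-irr x y y′ y-pow y′-pow y-exact y′-exact =
    let w , w-pow , related = power-compare p p-irr y y′ y-pow y′-pow
    in [ cofactor-1 y-pow y′-pow w-pow y-exact y′-exact
       , sym ∘ cofactor-1 y′-pow y-pow w-pow y′-exact y-exact ]′ related
    where
    cofactor-1 : ∀ {w y y′} → Power p y → Power p y′ → Power p w →
      ExactCofactor p x y → ExactCofactor p x y′ → y ≡ w * y′ → y ≡ y′
    cofactor-1 {w} {y} {y′} (y≢0 , _) (y′≢0 , _) (_ , w-fs , w-pow) (z , x≡zy , _) (z′ , x≡z′y′ , p∤z′) y≡wy′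
      with w-pow w (+ 1) (sym (*-identityˡ w))
    ... | inj₁ (inj₁ refl) = trans y≡wy′ (*-identityˡ y′)
    ... | inj₁ (inj₂ refl) with () ← fourSquares-antisym -[1+ 0 ] w-fs (lagrange 1)
    ... | inj₂ (k , w≡kp) = ⊥-elim (p∤z′ (z * k , (begin
      z′           ≡⟨ z*w≡z′ ⟨
      z * w        ≡⟨ cong (z *_) w≡kp ⟩
      z * (k * p)  ≡⟨ *-assoc z k p ⟨
      z * k * p    ∎)))
      where
      open ≡-Reasoning
      z*w≡z′ : z * w ≡ z′
      z*w≡z′ = *-cancelʳ-≡ (z * w) z′ y′ {{≢-nonZero y′≢0}}
        (trans (*-assoc z w y′) (trans (cong (z *_) (sym y≡wy′)) (trans (sym x≡zy) x≡z′y′)))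

-- Relativised quantifiers and transfer from ℤ to `*ℤ`

module FirstOrderTransfer where
  open import Data.Empty using (⊥)
  open import Data.Empty.Polymorphic using () renaming (⊥-elim to ⊥-elimᵖ)
  import Data.Integer.Properties as ℤ
  open import Data.Nat using (_+_)
  open import Data.Rational using (ℚ)
  import Data.Rational.Properties as ℚ
  import Data.Rational.Unnormalised as ℚᵘ
  import Data.Rational.Unnormalised.Properties as ℚᵘ
  open import Data.Vec using (Vec; []; _∷_; lookup; _++_; map)
  open import Data.Vec.Properties using (lookup-++ˡ; lookup-map)
  open import Relation.Binary.PropositionalEquality using (refl; sym; trans; cong; cong₂; subst)

  shift : ∀ {n} → Term n → Term (suc n)
  shift (var i)  = var (suc i)
  shift `0       = `0
  shift `1       = `1
  shift (s `+ t) = shift s `+ shift t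
  shift (s `* t) = shift s `* shift t
  shift (`- t)   = `- shift t

  x₀ : ∀ {n} → Term (suc n)
  x₀ = var zero

  x₁ : ∀ {n} → Term (suc (suc n))
  x₁ = shift x₀

  x₂ : ∀ {n} → Term (suc (suc (suc n)))
  x₂ = shift x₁

  x₃ : ∀ {n} → Term (suc (suc (suc (suc n))))
  x₃ = shift x₂

  x₄ : ∀ {n} → Term (suc (suc (suc (suc (suc n)))))
  x₄ = shift x₃

  infix 3.5 `¬_
  `¬_ : ∀ {n} → Formula n → Formula n
  `¬ φ = φ `⇒ `⊥

  -- The n new variables get the largest indices, so weaken n Z still speaks about variable 0.
  weakenᵗ : ∀ {m} n → Term m → Term (m + n)
  weakenᵗ n (var i)  = var (i ↑ˡ n)
  weakenᵗ n `0       = `0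
  weakenᵗ n `1       = `1
  weakenᵗ n (s `+ t) = weakenᵗ n s `+ weakenᵗ n t
  weakenᵗ n (s `* t) = weakenᵗ n s `* weakenᵗ n t
  weakenᵗ n (`- t)   = `- weakenᵗ n t

  weaken : ∀ {m} n → Formula m → Formula (m + n)
  weaken n (s `≈ t) = weakenᵗ n s `≈ weakenᵗ n t
  weaken n `⊥       = `⊥
  weaken n (φ `∧ ψ) = weaken n φ `∧ weaken n ψ
  weaken n (φ `∨ ψ) = weaken n φ `∨ weaken n ψ
  weaken n (φ `⇒ ψ) = weaken n φ `⇒ weaken n ψ
  weaken n (`∀ φ)   = `∀ weaken n φ
  weaken n (`∃ φ)   = `∃ weaken n φ

  module _ {c ℓ} (M : RawRing c ℓ) where
    open RawRing M using (Carrier; _≈_)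

    eval-weaken : ∀ {m n} (ρ : Vec Carrier m) (σ : Vec Carrier n) t →
      eval M (ρ ++ σ) (weakenᵗ n t) ≡ eval M ρ t
    eval-weaken ρ σ (var i)  = lookup-++ˡ ρ σ i
    eval-weaken ρ σ `0       = refl
    eval-weaken ρ σ `1       = refl
    eval-weaken ρ σ (s `+ t) = cong₂ (RawRing._+_ M) (eval-weaken ρ σ s) (eval-weaken ρ σ t)
    eval-weaken ρ σ (s `* t) = cong₂ (RawRing._*_ M) (eval-weaken ρ σ s) (eval-weaken ρ σ t)
    eval-weaken ρ σ (`- t)   = cong (RawRing.-_ M) (eval-weaken ρ σ t)

    Sat-weaken : ∀ {m n} (ρ : Vec Carrier m) (σ : Vec Carrier n) φ →
      Sat M (ρ ++ σ) (weaken n φ) ⇔ Sat M ρ φ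
    Sat-weaken {n = n} ρ σ (s `≈ t)
      rewrite eval-weaken ρ σ s | eval-weaken ρ σ t = mk⇔ id id
    Sat-weaken ρ σ `⊥ = mk⇔ id id
    Sat-weaken ρ σ (φ `∧ ψ) = mk⇔
      (λ (p , q) → to (Sat-weaken ρ σ φ) p , to (Sat-weaken ρ σ ψ) q)
      (λ (p , q) → from (Sat-weaken ρ σ φ) p , from (Sat-weaken ρ σ ψ) q)
    Sat-weaken ρ σ (φ `∨ ψ) = mk⇔
      (Sum.map (to (Sat-weaken ρ σ φ)) (to (Sat-weaken ρ σ ψ)))
      (Sum.map (from (Sat-weaken ρ σ φ)) (from (Sat-weaken ρ σ ψ)))
    Sat-weaken ρ σ (φ `⇒ ψ) = mk⇔
      (λ f → to (Sat-weaken ρ σ ψ) ∘ f ∘ from (Sat-weaken ρ σ φ))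
      (λ f → from (Sat-weaken ρ σ ψ) ∘ f ∘ to (Sat-weaken ρ σ φ))
    Sat-weaken ρ σ (`∀ φ) = mk⇔
      (λ f x → to (Sat-weaken (x ∷ ρ) σ φ) (f x))
      (λ f x → from (Sat-weaken (x ∷ ρ) σ φ) (f x))
    Sat-weaken ρ σ (`∃ φ) = mk⇔
      (λ (x , p) → x , to (Sat-weaken (x ∷ ρ) σ φ) p)
      (λ (x , p) → x , from (Sat-weaken (x ∷ ρ) σ φ) p)

    -- Satisfaction with all quantifiers restricted to the image of ι. Its universe
    -- level depends on the formula so that atoms are equations, without any Lift.
    module Restricted {i} (I : Set i) (ι : I → Carrier) where

      level : ∀ {n} → Formula n → Level
      level (s `≈ t) = ℓ
      level `⊥       = 0ℓ
      level (φ `∧ ψ) = level φ ⊔ level ψ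
      level (φ `∨ ψ) = level φ ⊔ level ψ
      level (φ `⇒ ψ) = level φ ⊔ level ψ
      level (`∀ φ)   = i ⊔ level φ
      level (`∃ φ)   = i ⊔ level φ

      Satᴿ : ∀ {n} → Vec Carrier n → (φ : Formula n) → Set (level φ)
      Satᴿ ρ (s `≈ t) = eval M ρ s ≈ eval M ρ t
      Satᴿ ρ `⊥       = ⊥
      Satᴿ ρ (φ `∧ ψ) = Satᴿ ρ φ × Satᴿ ρ ψ
      Satᴿ ρ (φ `∨ ψ) = Satᴿ ρ φ ⊎ Satᴿ ρ ψ
      Satᴿ ρ (φ `⇒ ψ) = Satᴿ ρ φ → Satᴿ ρ ψ
      Satᴿ ρ (`∀ φ)   = ∀ x → Satᴿ (ι x ∷ ρ) φ
      Satᴿ ρ (`∃ φ)   = ∃[ x ] Satᴿ (ι x ∷ ρ) φ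

  module Relativisation (Z : Formula 1) where

    relativise : ∀ {n} → Formula n → Formula n
    relativise (s `≈ t)     = s `≈ t
    relativise `⊥           = `⊥
    relativise (φ `∧ ψ)     = relativise φ `∧ relativise ψ
    relativise (φ `∨ ψ)     = relativise φ `∨ relativise ψ
    relativise (φ `⇒ ψ)     = relativise φ `⇒ relativise ψ
    relativise {n} (`∀ φ)   = `∀ (weaken n Z `⇒ relativise φ)
    relativise {n} (`∃ φ)   = `∃ (weaken n Z `∧ relativise φ)

    module _ {c ℓ i} (M : RawRing c ℓ) (I : Set i) (ι : I → RawRing.Carrier M)
             (Z⇔image : ∀ x → Sat M (x ∷ []) Z ⇔ (∃[ j ] x ≡ ι j)) where
      open Restricted M I ι

      -- `Z⇔image` identifies the elements satisfying Z with the image of ι up to propositional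
      -- equality, so exchanging a bounded quantifier for one over `I` is a pattern match that does
      -- not require satisfaction to respect the setoid equality.
      Sat-relativise : ∀ {n} (ρ : Vec (RawRing.Carrier M) n) φ → Sat M ρ (relativise φ) ⇔ Satᴿ ρ φ
      Sat-relativise ρ (s `≈ t) = mk⇔ lower lift
      Sat-relativise ρ `⊥ = mk⇔ (λ ()) (λ ())
      Sat-relativise ρ (φ `∧ ψ) = mk⇔
        (λ (p , q) → to (Sat-relativise ρ φ) p , to (Sat-relativise ρ ψ) q)
        (λ (p , q) → from (Sat-relativise ρ φ) p , from (Sat-relativise ρ ψ) q)
      Sat-relativise ρ (φ `∨ ψ) = mk⇔
        (Sum.map (to (Sat-relativise ρ φ)) (to (Sat-relativise ρ ψ)))
        (Sum.map (from (Sat-relativise ρ φ)) (from (Sat-relativise ρ ψ)))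
      Sat-relativise ρ (φ `⇒ ψ) = mk⇔
        (λ f → to (Sat-relativise ρ ψ) ∘ f ∘ from (Sat-relativise ρ φ))
        (λ f → from (Sat-relativise ρ ψ) ∘ f ∘ to (Sat-relativise ρ φ))
      Sat-relativise ρ (`∀ φ) = mk⇔
        (λ f j → to (Sat-relativise (ι j ∷ ρ) φ)
          (f (ι j) (from (Sat-weaken M (ι j ∷ []) ρ Z) (from (Z⇔image (ι j)) (j , refl)))))
        (λ f x Zx → case-image f (to (Z⇔image x) (to (Sat-weaken M (x ∷ []) ρ Z) Zx)))
        where
        case-image : (∀ j → Satᴿ (ι j ∷ ρ) φ) → ∀ {x} → ∃[ j ] x ≡ ι j → Sat M (x ∷ ρ) (relativise φ)
        case-image f (j , refl) = from (Sat-relativise (ι j ∷ ρ) φ) (f j)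
      Sat-relativise ρ (`∃ φ) = mk⇔
        (λ (x , Zx , p) → case-image p (to (Z⇔image x) (to (Sat-weaken M (x ∷ []) ρ Z) Zx)))
        (λ (j , p) → ι j , from (Sat-weaken M (ι j ∷ []) ρ Z) (from (Z⇔image (ι j)) (j , refl)) ,
                     from (Sat-relativise (ι j ∷ ρ) φ) p)
        where
        case-image : ∀ {x} → Sat M (x ∷ ρ) (relativise φ) → ∃[ j ] x ≡ ι j → ∃[ j ] Satᴿ (ι j ∷ ρ) φ
        case-image p (j , refl) = j , to (Sat-relativise (ι j ∷ ρ) φ) p

  _/1 : ℤ → ℚ
  n /1 = n ℚ./ 1

  -- Identities between the n /1 are checked on unnormalised fractions, where no gcd intervenes, and
  -- carried back by injectivity of `toℚᵘ`. The 0 in `mkℚᵘ n 0` is the denominator minus one.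
  toℚᵘ-/1 : ∀ n → ℚ.toℚᵘ (n /1) ℚᵘ.≃ ℚᵘ.mkℚᵘ n 0
  toℚᵘ-/1 n = ℚ.toℚᵘ-fromℚᵘ (ℚᵘ.mkℚᵘ n 0)

  /1-injective : ∀ {m n} → m /1 ≡ n /1 → m ≡ n
  /1-injective {m} {n} eq with ℚ.fromℚᵘ-injective {ℚᵘ.mkℚᵘ m 0} {ℚᵘ.mkℚᵘ n 0} eq
  ... | ℚᵘ.*≡* m*1≡n*1 = trans (sym (ℤ.*-identityʳ m)) (trans m*1≡n*1 (ℤ.*-identityʳ n))

  /1-homo-+ : ∀ m n → m /1 ℚ.+ n /1 ≡ (m ℤ.+ n) /1
  /1-homo-+ m n = ℚ.toℚᵘ-injective (ℚᵘ.≃-trans (ℚ.toℚᵘ-homo-+ (m /1) (n /1))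
    (ℚᵘ.≃-trans (ℚᵘ.+-cong (toℚᵘ-/1 m) (toℚᵘ-/1 n))
    (ℚᵘ.≃-trans (ℚᵘ.*≡* (cong (ℤ._* ℤ.+ 1) (cong₂ ℤ._+_ (ℤ.*-identityʳ m) (ℤ.*-identityʳ n))))
      (ℚᵘ.≃-sym (toℚᵘ-/1 (m ℤ.+ n))))))

  /1-homo-* : ∀ m n → m /1 ℚ.* n /1 ≡ (m ℤ.* n) /1
  /1-homo-* m n = ℚ.toℚᵘ-injective (ℚᵘ.≃-trans (ℚ.toℚᵘ-homo-* (m /1) (n /1))
    (ℚᵘ.≃-trans (ℚᵘ.*-cong (toℚᵘ-/1 m) (toℚᵘ-/1 n)) (ℚᵘ.≃-sym (toℚᵘ-/1 (m ℤ.* n)))))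

  /1-homo-neg : ∀ n → ℚ.- (n /1) ≡ (ℤ.- n) /1
  /1-homo-neg n = ℚ.toℚᵘ-injective (ℚᵘ.≃-trans (ℚ.toℚᵘ-homo‿- (n /1))
    (ℚᵘ.≃-trans (ℚᵘ.-‿cong (toℚᵘ-/1 n)) (ℚᵘ.≃-sym (toℚᵘ-/1 (ℤ.- n)))))

  *-↧≡↥ : ∀ q → q ℚ.* (ℚ.↧ q) /1 ≡ (ℚ.↥ q) /1
  *-↧≡↥ q@record{} = ℚ.toℚᵘ-injective (ℚᵘ.≃-trans (ℚ.toℚᵘ-homo-* q ((ℚ.↧ q) /1))
    (ℚᵘ.≃-trans (ℚᵘ.*-cong (ℚᵘ.≃-refl {ℚ.toℚᵘ q}) (toℚᵘ-/1 (ℚ.↧ q)))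
    (ℚᵘ.≃-trans (ℚᵘ.*≡* (trans (ℤ.*-identityʳ (ℚ.↥ q ℤ.* ℚ.↧ q))
      (cong (λ t → ℚ.↥ q ℤ.* ℤ.+ t) (sym (ℕ.*-identityʳ (ℚ.↧ₙ q))))))
      (ℚᵘ.≃-sym (toℚᵘ-/1 (ℚ.↥ q))))))

  module ℤᴿ = Restricted ℤ.+-*-rawRing ℤ id
  module ℚᴿ = Restricted ℚ.+-*-rawRing ℤ _/1

  evalℤ : ∀ {n} → Vec ℤ n → Term n → ℤ
  evalℤ = eval ℤ.+-*-rawRing

  eval-/1 : ∀ {n} (ρ : Vec ℤ n) t →
    eval ℚ.+-*-rawRing (map _/1 ρ) t ≡ evalℤ ρ t /1
  eval-/1 ρ (var i)  = lookup-map i _/1 ρ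
  eval-/1 ρ `0       = refl
  eval-/1 ρ `1       = refl
  eval-/1 ρ (s `+ t) = trans (cong₂ ℚ._+_ (eval-/1 ρ s) (eval-/1 ρ t)) (/1-homo-+ (evalℤ ρ s) (evalℤ ρ t))
  eval-/1 ρ (s `* t) = trans (cong₂ ℚ._*_ (eval-/1 ρ s) (eval-/1 ρ t)) (/1-homo-* (evalℤ ρ s) (evalℤ ρ t))
  eval-/1 ρ (`- t)   = trans (cong ℚ.-_ (eval-/1 ρ t)) (/1-homo-neg (evalℤ ρ t))

  -- On atoms, one direction uses that `_/1` is a homomorphism and the other that it is also
  -- injective. The directions are proved together because an implication interchanges them.
  Satᴿ-/1 : ∀ {n} (ρ : Vec ℤ n) φ → ℤᴿ.Satᴿ ρ φ ⇔ ℚᴿ.Satᴿ (map _/1 ρ) φ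
  Satᴿ-/1 ρ (s `≈ t) = mk⇔
    (λ e → trans (eval-/1 ρ s) (trans (cong _/1 e) (sym (eval-/1 ρ t))))
    (λ e → /1-injective (trans (sym (eval-/1 ρ s)) (trans e (eval-/1 ρ t))))
  Satᴿ-/1 ρ `⊥ = mk⇔ id id
  Satᴿ-/1 ρ (φ `∧ ψ) = mk⇔
    (λ (p , q) → to (Satᴿ-/1 ρ φ) p , to (Satᴿ-/1 ρ ψ) q)
    (λ (p , q) → from (Satᴿ-/1 ρ φ) p , from (Satᴿ-/1 ρ ψ) q)
  Satᴿ-/1 ρ (φ `∨ ψ) = mk⇔
    (Sum.map (to (Satᴿ-/1 ρ φ)) (to (Satᴿ-/1 ρ ψ)))
    (Sum.map (from (Satᴿ-/1 ρ φ)) (from (Satᴿ-/1 ρ ψ)))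
  Satᴿ-/1 ρ (φ `⇒ ψ) = mk⇔
    (λ f → to (Satᴿ-/1 ρ ψ) ∘ f ∘ from (Satᴿ-/1 ρ φ))
    (λ f → from (Satᴿ-/1 ρ ψ) ∘ f ∘ to (Satᴿ-/1 ρ φ))
  Satᴿ-/1 ρ (`∀ φ) = mk⇔
    (λ f n → to (Satᴿ-/1 (n ∷ ρ) φ) (f n))
    (λ f n → from (Satᴿ-/1 (n ∷ ρ) φ) (f n))
  Satᴿ-/1 ρ (`∃ φ) = mk⇔
    (λ (n , p) → n , to (Satᴿ-/1 (n ∷ ρ) φ) p)
    (λ (n , p) → n , from (Satᴿ-/1 (n ∷ ρ) φ) p)

  module Transfer {c ℓ} (*ℚ : Field c ℓ)
    (*ℚ≡ℚ : ElementarilyEquivalent (Field.rawRing *ℚ) ℚ.+-*-rawRing)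
    (Z : Formula 1) (Z-defines-ℤ : DefinesℤInℚ Z) where
    open Field *ℚ using (Carrier; _≈_; _*_; 0#; rawRing)
    open Arithmetic *ℚ Z using (*ℤ)
    open Relativisation Z

    *Int : Set _
    *Int = Σ Carrier *ℤ

    module *ℤᴿ = Restricted rawRing *Int proj₁

    abstract
      -- Truth in ℤ is read in ℚ with quantifiers over the integers, then as a sentence relativised
      -- to Z; this passes to `*ℚ` by elementary equivalence and is read back there. Indexing by
      -- `*Int` makes the image condition for `*ℤ` hold by definition.
      transfer : ∀ φ → ℤᴿ.Satᴿ [] φ → *ℤᴿ.Satᴿ [] φ
      transfer φ ℤ⊨φ = to (Sat-relativise rawRing *Int proj₁ (λ x → mk⇔ (λ Zx → (x , Zx) , refl) λ { (j , refl) → proj₂ j }) [] φ)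
        (from (*ℚ≡ℚ (relativise φ))
          (from (Sat-relativise ℚ.+-*-rawRing ℤ _/1 Z-defines-ℤ [] φ) (to (Satᴿ-/1 [] φ) ℤ⊨φ)))

    -- Unlike the later sentences these speak about all of ℚ, so they are transferred without
    -- relativisation. The first licenses case distinctions on equality, the second makes `*ℤ` a
    -- subset of the setoid, the third writes every element as a quotient of integers.
    decidable-equalityᶠ respects-≈ᶠ fractionsᶠ : Formula 0
    decidable-equalityᶠ = `∀ `∀ (x₁ `≈ x₀ `∨ `¬ x₁ `≈ x₀)
    respects-≈ᶠ = `∀ (Z `⇒ (`∀ (x₁ `≈ x₀ `⇒ weaken 1 Z)))
    fractionsᶠ = `∀ `∃ (weaken 1 Z `∧ (`∃ (weaken 2 Z `∧ (`¬ x₀ `≈ `0) `∧ x₂ `* x₀ `≈ x₁)))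

    ℚ⊨decidable-equality : Sat ℚ.+-*-rawRing [] decidable-equalityᶠ
    ℚ⊨decidable-equality p q with p ℚ.≟ q
    ... | yes p≡q = inj₁ (lift p≡q)
    ... | no p≢q  = inj₂ λ p≡q → ⊥-elim (p≢q (lower p≡q))

    ℚ⊨respects-≈ : Sat ℚ.+-*-rawRing [] respects-≈ᶠ
    ℚ⊨respects-≈ p p∈ _ (lift refl) = from (Sat-weaken ℚ.+-*-rawRing (p ∷ []) (p ∷ []) Z) p∈

    ℚ⊨fractions : Sat ℚ.+-*-rawRing [] fractionsᶠ
    ℚ⊨fractions q =
      (ℚ.↥ q) /1 , from (Sat-weaken ℚ.+-*-rawRing ((ℚ.↥ q) /1 ∷ []) (q ∷ []) Z) (from (Z-defines-ℤ _) (ℚ.↥ q , refl)) ,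
      (ℚ.↧ q) /1 , from (Sat-weaken ℚ.+-*-rawRing ((ℚ.↧ q) /1 ∷ []) ((ℚ.↥ q) /1 ∷ q ∷ []) Z) (from (Z-defines-ℤ _) (ℚ.↧ q , refl)) ,
      (λ ↧q≡0 → ⊥-elim (↧≢0 (/1-injective {ℚ.↧ q} {ℤ.+ 0} (lower ↧q≡0)))) , lift (*-↧≡↥ q)
      where
      ↧≢0 : ¬ (ℚ.↧ q ≡ ℤ.+ 0)
      ↧≢0 ()

    abstract
      ≈-decidable : ∀ x y → x ≈ y ⊎ ¬ (x ≈ y)
      ≈-decidable x y = Sum.map lower (λ x≉y x≈y → ⊥-elimᵖ (x≉y (lift x≈y)))
        (from (*ℚ≡ℚ decidable-equalityᶠ) ℚ⊨decidable-equality x y)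

      *ℤ-resp-≈ : ∀ {x y} → x ≈ y → *ℤ x → *ℤ y
      *ℤ-resp-≈ {x} {y} x≈y x∈ = to (Sat-weaken rawRing (y ∷ []) (x ∷ []) Z)
        (from (*ℚ≡ℚ respects-≈ᶠ) ℚ⊨respects-≈ x x∈ y (lift x≈y))

      fraction : ∀ q → ∃[ a ] ∃[ b ] *ℤ a × *ℤ b × ¬ (b ≈ 0#) × q * b ≈ a
      fraction q =
        let a , a∈ , b , b∈ , b≉0 , qb≈a = from (*ℚ≡ℚ fractionsᶠ) ℚ⊨fractions q
        in a , b , to (Sat-weaken rawRing (a ∷ []) (q ∷ []) Z) a∈ ,
           to (Sat-weaken rawRing (b ∷ []) (a ∷ q ∷ []) Z) b∈ ,
           (λ b≈0 → ⊥-elimᵖ (b≉0 (lift b≈0))) , lower qb≈a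

-- Formulas for the divisibility notions and their transfer

open FirstOrderTransfer using (shift; x₀; x₁; x₂; x₃; x₄; `¬_)

-- This and the following formulas unfold under restricted satisfaction to the predicates of the
-- same names in `Divisibility`, over ℤ and over `*ℤ` alike. Theorems about ℤ can therefore be
-- handed to `transfer` as they are.
`Unit : ∀ {n} → Term n → Formula n
`Unit t = t `≈ `1 `∨ t `≈ `- `1

`Multiple : ∀ {n} → Term n → Term n → Formula n
`Multiple p t = `∃ (shift t `≈ x₀ `* shift p)

`Irreducible : ∀ {n} → Term n → Formula n
`Irreducible p = (`¬ p `≈ `0) `∧ (`¬ `Unit p) `∧ (`∀ `∀ (shift (shift p) `≈ x₀ `* x₁ `⇒
  x₁ `≈ `1 `∨ x₁ `≈ `- `1 `∨ x₁ `≈ shift (shift p) `∨ x₁ `≈ `- shift (shift p)))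

`FourSquares : ∀ {n} → Term n → Formula n
`FourSquares t = `∃ `∃ `∃ `∃
  (shift (shift (shift (shift t))) `≈ x₃ `* x₃ `+ x₂ `* x₂ `+ x₁ `* x₁ `+ x₀ `* x₀)

`Power : ∀ {n} → Term n → Term n → Formula n
`Power p t = (`¬ t `≈ `0) `∧ `FourSquares t `∧ (`∀ `∀ (shift (shift t) `≈ x₀ `* x₁ `⇒ `Unit x₁ `∨ `Multiple (shift (shift p)) x₁))

`ExactCofactor : ∀ {n} → Term n → Term n → Term n → Formula n
`ExactCofactor p s t = `∃ (shift s `≈ x₀ `* shift t `∧ `¬ `Multiple (shift p) x₀)

module Integers {c ℓ} (*ℚ : Field c ℓ)
  (*ℚ≡ℚ : ElementarilyEquivalent (Field.rawRing *ℚ) ℚ.+-*-rawRing)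
  (Z : Formula 1) (Z-defines-ℤ : DefinesℤInℚ Z) where
  open Field *ℚ using (Carrier; _≈_; _+_; _*_; -_; 0#; 1#; rawRing)
  open FirstOrderTransfer.Transfer *ℚ *ℚ≡ℚ Z Z-defines-ℤ public
  open Divisibility rawRing *Int proj₁ public

  abstract
    -- Transferred quantifiers range over `*Int`, so closure of `*ℤ` under the ring operations is
    -- phrased as the existence of an integer equal to the given value. `*ℤ-resp-≈` later turns this
    -- into membership.
    integer-0 : Σ[ z ∈ *Int ] proj₁ z ≈ 0#
    integer-0 = transfer (`∃ (x₀ `≈ `0)) (_ , ≡.refl)

    integer-1 : Σ[ z ∈ *Int ] proj₁ z ≈ 1#
    integer-1 = transfer (`∃ (x₀ `≈ `1)) (_ , ≡.refl)

    integer-+ : ∀ (x y : *Int) → Σ[ z ∈ *Int ] proj₁ z ≈ proj₁ x + proj₁ y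
    integer-+ = transfer (`∀ `∀ `∃ (x₀ `≈ x₂ `+ x₁)) λ _ _ → _ , ≡.refl

    integer-* : ∀ (x y : *Int) → Σ[ z ∈ *Int ] proj₁ z ≈ proj₁ x * proj₁ y
    integer-* = transfer (`∀ `∀ `∃ (x₀ `≈ x₂ `* x₁)) λ _ _ → _ , ≡.refl

    integer-neg : ∀ (x : *Int) → Σ[ z ∈ *Int ] proj₁ z ≈ - proj₁ x
    integer-neg = transfer (`∀ `∃ (x₀ `≈ `- x₁)) λ _ → _ , ≡.refl

    fourSquares-total : ∀ (x : *Int) → FourSquares (proj₁ x) ⊎ FourSquares (- proj₁ x)
    fourSquares-total = transfer (`∀ (`FourSquares x₀ `∨ `FourSquares (`- x₀))) IntegerArithmetic.fourSquares-total

    fourSquares-antisym : ∀ (x : *Int) → FourSquares (proj₁ x) → FourSquares (- proj₁ x) → proj₁ x ≈ 0#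
    fourSquares-antisym = transfer (`∀ (`FourSquares x₀ `⇒ `FourSquares (`- x₀) `⇒ x₀ `≈ `0)) IntegerArithmetic.fourSquares-antisym

    fourSquares-* : ∀ (x y : *Int) → FourSquares (proj₁ x) → FourSquares (proj₁ y) → FourSquares (proj₁ x * proj₁ y)
    fourSquares-* = transfer (`∀ `∀ (`FourSquares x₁ `⇒ `FourSquares x₀ `⇒ `FourSquares (x₁ `* x₀)))
      λ _ _ → LagrangeFourSquares.fourSquares-*

    factor-of-1⇒unit : ∀ (u w : *Int) → proj₁ u * proj₁ w ≈ 1# → Unit (proj₁ w)
    factor-of-1⇒unit = transfer (`∀ `∀ (x₁ `* x₀ `≈ `1 `⇒ `Unit x₀)) IntegerArithmetic.factor-of-1⇒unit

    coprime-cofactors : ∀ (x y : *Int) → Σ[ g ∈ *Int ] Σ[ x′ ∈ *Int ] Σ[ y′ ∈ *Int ]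
      proj₁ x ≈ proj₁ g * proj₁ x′ × proj₁ y ≈ proj₁ g * proj₁ y′ ×
      (∀ (d : *Int) → Multiple (proj₁ d) (proj₁ x′) → Multiple (proj₁ d) (proj₁ y′) → Unit (proj₁ d))
    coprime-cofactors = transfer
      (`∀ `∀ `∃ `∃ `∃ (x₄ `≈ x₂ `* x₁ `∧ x₃ `≈ x₂ `* x₀ `∧
        (`∀ (`Multiple x₀ x₂ `⇒ `Multiple x₀ x₁ `⇒ `Unit x₀))))
      IntegerArithmetic.coprime-cofactors

    prime-factor : ∀ (x : *Int) → ¬ (proj₁ x ≈ 0#) → ¬ Unit (proj₁ x) →
      Σ[ p ∈ *Int ] Irreducible (proj₁ p) × FourSquares (proj₁ p) × Multiple (proj₁ p) (proj₁ x)
    prime-factor = transfer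
      (`∀ ((`¬ x₀ `≈ `0) `⇒ (`¬ `Unit x₀) `⇒ (`∃ (`Irreducible x₀ `∧ `FourSquares x₀ `∧ `Multiple x₀ x₁))))
      IntegerArithmetic.prime-factor

    euclid : ∀ (p : *Int) → Irreducible (proj₁ p) → ∀ (a b : *Int) →
      Multiple (proj₁ p) (proj₁ a * proj₁ b) → Multiple (proj₁ p) (proj₁ a) ⊎ Multiple (proj₁ p) (proj₁ b)
    euclid = transfer
      (`∀ (`Irreducible x₀ `⇒ (`∀ `∀ (`Multiple x₂ (x₁ `* x₀) `⇒ `Multiple x₂ x₁ `∨ `Multiple x₂ x₀))))
      IntegerArithmetic.euclid

    power-1 : ∀ (p : *Int) → Power (proj₁ p) 1#
    power-1 = transfer (`∀ `Power x₀ `1) IntegerArithmetic.power-1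

    power-* : ∀ (p x y : *Int) → Power (proj₁ p) (proj₁ x) → Power (proj₁ p) (proj₁ y) →
      Power (proj₁ p) (proj₁ x * proj₁ y)
    power-* = transfer
      (`∀ `∀ `∀ (`Power x₂ x₁ `⇒ `Power x₂ x₀ `⇒ `Power x₂ (x₁ `* x₀)))
      IntegerArithmetic.power-*

    power-compare : ∀ (p : *Int) → Irreducible (proj₁ p) → ∀ (x y : *Int) →
      Power (proj₁ p) (proj₁ x) → Power (proj₁ p) (proj₁ y) →
      Σ[ w ∈ *Int ] Power (proj₁ p) (proj₁ w) × (proj₁ x ≈ proj₁ w * proj₁ y ⊎ proj₁ y ≈ proj₁ w * proj₁ x)
    power-compare = transfer
      (`∀ (`Irreducible x₀ `⇒ (`∀ `∀ (`Power x₂ x₁ `⇒ `Power x₂ x₀ `⇒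
        (`∃ (`Power x₃ x₀ `∧ (x₂ `≈ x₀ `* x₁ `∨ x₁ `≈ x₀ `* x₂)))))))
      IntegerArithmetic.power-compare

    exact-exists : ∀ (p : *Int) → Irreducible (proj₁ p) → FourSquares (proj₁ p) → ∀ (x : *Int) → ¬ (proj₁ x ≈ 0#) →
      Σ[ y ∈ *Int ] Power (proj₁ p) (proj₁ y) × ExactCofactor (proj₁ p) (proj₁ x) (proj₁ y)
    exact-exists = transfer
      (`∀ (`Irreducible x₀ `⇒ `FourSquares x₀ `⇒ (`∀ ((`¬ x₀ `≈ `0) `⇒ (`∃ (`Power x₂ x₀ `∧ `ExactCofactor x₂ x₁ x₀))))))
      IntegerArithmetic.exact-exists

    exact-unique : ∀ (p : *Int) → Irreducible (proj₁ p) → ∀ (x y y′ : *Int) →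
      Power (proj₁ p) (proj₁ y) → Power (proj₁ p) (proj₁ y′) →
      ExactCofactor (proj₁ p) (proj₁ x) (proj₁ y) → ExactCofactor (proj₁ p) (proj₁ x) (proj₁ y′) →
      proj₁ y ≈ proj₁ y′
    exact-unique = transfer
      (`∀ (`Irreducible x₀ `⇒ (`∀ `∀ `∀ (`Power x₃ x₁ `⇒ `Power x₃ x₀ `⇒
        `ExactCofactor x₃ x₂ x₁ `⇒ `ExactCofactor x₃ x₂ x₀ `⇒ x₁ `≈ x₀))))
      IntegerArithmetic.exact-unique

module _ {a ℓ₁ b ℓ₂} (G : Group a ℓ₁) (H : Group b ℓ₂) where
  private
    module G = Group G
    module H = Group H

  multiplicative⇒homomorphism : (f : G.Carrier → H.Carrier) →
    (∀ {x y} → x G.≈ y → f x H.≈ f y) → (∀ x y → f (x G.∙ y) H.≈ f x H.∙ f y) →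
    IsGroupHomomorphism G.rawGroup H.rawGroup f
  multiplicative⇒homomorphism f f-cong f-homo = record
    { isMonoidHomomorphism = record
      { isMagmaHomomorphism = record
        { isRelHomomorphism = record { cong = f-cong }
        ; homo = f-homo
        }
      ; ε-homo = ε-homo
      }
    ; ⁻¹-homo = λ x → GroupProperties.inverseˡ-unique H (f (x G.⁻¹)) (f x)
        (H.trans (H.sym (f-homo (x G.⁻¹) x)) (H.trans (f-cong (G.inverseˡ x)) ε-homo))
    }
    where
    ε-homo : f G.ε H.≈ H.ε
    ε-homo = GroupProperties.∙-cancelˡ H (f G.ε) (f G.ε) H.ε
      (H.trans (H.sym (f-homo G.ε G.ε)) (H.trans (f-cong (G.identityˡ G.ε)) (H.sym (H.identityʳ (f G.ε)))))

-- Arithmetic in `*ℤ` and `*ℚ`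

module NonstandardRationals {c ℓ} (*ℚ : Field c ℓ)
  (*ℚ≡ℚ : ElementarilyEquivalent (Field.rawRing *ℚ) ℚ.+-*-rawRing)
  (Z : Formula 1) (Z-defines-ℤ : DefinesℤInℚ Z) where
  open Field *ℚ
  open Arithmetic *ℚ Z
  open Integers *ℚ *ℚ≡ℚ Z Z-defines-ℤ
  open ≈-Reasoning setoid
  open import Algebra.Solver.Ring.NaturalCoefficients.Default commutativeSemiring
    using (solve; _:=_; _:*_; _:+_; con)
  open import Algebra.Properties.Ring ring using (-‿distribˡ-*; -‿distribʳ-*; -‿involutive; -0#≈0#)

  cancelʳ : ∀ {x y z} → ¬ (z ≈ 0#) → x * z ≈ y * z → x ≈ y
  cancelʳ {x} {y} {z} z≉0 xz≈yz = begin
    x                  ≈⟨ divide x ⟨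
    x * z * z⁻¹        ≈⟨ *-congʳ xz≈yz ⟩
    y * z * z⁻¹        ≈⟨ divide y ⟩
    y                  ∎
    where
    z⁻¹ = proj₁ (inverse z z≉0)
    divide : ∀ t → t * z * z⁻¹ ≈ t
    divide t = trans (*-assoc t z z⁻¹) (trans (*-congˡ (proj₂ (inverse z z≉0))) (*-identityʳ t))

  nonzeroˡ : ∀ {x y} → ¬ (x * y ≈ 0#) → ¬ (x ≈ 0#)
  nonzeroˡ xy≉0 x≈0 = xy≉0 (trans (*-congʳ x≈0) (zeroˡ _))

  nonzeroʳ : ∀ {x y} → ¬ (x * y ≈ 0#) → ¬ (y ≈ 0#)
  nonzeroʳ xy≉0 y≈0 = xy≉0 (trans (*-congˡ y≈0) (zeroʳ _))

  nonzero-* : ∀ {x y} → ¬ (x ≈ 0#) → ¬ (y ≈ 0#) → ¬ (x * y ≈ 0#)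
  nonzero-* x≉0 y≉0 = proj₂ ((_ , x≉0) ˣ.∙ (_ , y≉0))

  ≉-resp : ∀ {x y} → x ≈ y → ¬ (x ≈ 0#) → ¬ (y ≈ 0#)
  ≉-resp x≈y x≉0 y≈0 = x≉0 (trans x≈y y≈0)

  neg-nonzero : ∀ {x} → ¬ (x ≈ 0#) → ¬ (- x ≈ 0#)
  neg-nonzero {x} x≉0 -x≈0 = x≉0 (trans (sym (-‿involutive x)) (trans (-‿cong -x≈0) -0#≈0#))

  *ℤ-0 : *ℤ 0#
  *ℤ-0 = let (z , z∈) , z≈ = integer-0 in *ℤ-resp-≈ z≈ z∈

  *ℤ-1 : *ℤ 1#
  *ℤ-1 = let (z , z∈) , z≈ = integer-1 in *ℤ-resp-≈ z≈ z∈

  *ℤ-+ : ∀ {x y} → *ℤ x → *ℤ y → *ℤ (x + y)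
  *ℤ-+ x∈ y∈ = let (z , z∈) , z≈ = integer-+ (_ , x∈) (_ , y∈) in *ℤ-resp-≈ z≈ z∈

  *ℤ-* : ∀ {x y} → *ℤ x → *ℤ y → *ℤ (x * y)
  *ℤ-* x∈ y∈ = let (z , z∈) , z≈ = integer-* (_ , x∈) (_ , y∈) in *ℤ-resp-≈ z≈ z∈

  *ℤ-neg : ∀ {x} → *ℤ x → *ℤ (- x)
  *ℤ-neg x∈ = let (z , z∈) , z≈ = integer-neg (_ , x∈) in *ℤ-resp-≈ z≈ z∈

  *ℕ⇒fourSquares : ∀ {x} → *ℕ x → FourSquares x
  *ℕ⇒fourSquares (a , b , e , f , a∈ , b∈ , e∈ , f∈ , x≈) = (a , a∈) , (b , b∈) , (e , e∈) , (f , f∈) , x≈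

  fourSquares⇒*ℕ : ∀ {x} → FourSquares x → *ℕ x
  fourSquares⇒*ℕ ((a , a∈) , (b , b∈) , (e , e∈) , (f , f∈) , x≈) = a , b , e , f , a∈ , b∈ , e∈ , f∈ , x≈

  *ℕ⇒*ℤ : ∀ {x} → *ℕ x → *ℤ x
  *ℕ⇒*ℤ (a , b , e , f , a∈ , b∈ , e∈ , f∈ , x≈) = *ℤ-resp-≈ (sym x≈)
    (*ℤ-+ (*ℤ-+ (*ℤ-+ (*ℤ-* a∈ a∈) (*ℤ-* b∈ b∈)) (*ℤ-* e∈ e∈)) (*ℤ-* f∈ f∈))

  *ℕ-resp-≈ : ∀ {x y} → x ≈ y → *ℕ x → *ℕ y
  *ℕ-resp-≈ x≈y (a , b , e , f , a∈ , b∈ , e∈ , f∈ , x≈) =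
    a , b , e , f , a∈ , b∈ , e∈ , f∈ , trans (sym x≈y) x≈

  *ℕ-square : ∀ {x} → *ℤ x → *ℕ (x * x)
  *ℕ-square {x} x∈ = x , 0# , 0# , 0# , x∈ , *ℤ-0 , *ℤ-0 , *ℤ-0 ,
    solve 1 (λ x → x :* x := x :* x :+ con 0 :* con 0 :+ con 0 :* con 0 :+ con 0 :* con 0) refl x

  *ℕ-1 : *ℕ 1#
  *ℕ-1 = *ℕ-resp-≈ (*-identityˡ 1#) (*ℕ-square *ℤ-1)

  *ℕ-* : ∀ {x y} → *ℕ x → *ℕ y → *ℕ (x * y)
  *ℕ-* x∈ y∈ = fourSquares⇒*ℕ (fourSquares-* (_ , *ℕ⇒*ℤ x∈) (_ , *ℕ⇒*ℤ y∈) (*ℕ⇒fourSquares x∈) (*ℕ⇒fourSquares y∈))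

  *ℕ-total : ∀ {x} → *ℤ x → *ℕ x ⊎ *ℕ (- x)
  *ℕ-total x∈ = Sum.map fourSquares⇒*ℕ fourSquares⇒*ℕ (fourSquares-total (_ , x∈))

  *ℕ-antisym : ∀ {x} → *ℕ x → *ℕ (- x) → x ≈ 0#
  *ℕ-antisym x∈ -x∈ = fourSquares-antisym (_ , *ℕ⇒*ℤ x∈) (*ℕ⇒fourSquares x∈) (*ℕ⇒fourSquares -x∈)

  ∣⇒multiple : ∀ {x y} → x ∣ y → Multiple x y
  ∣⇒multiple (z , z∈ , _ , y≈zx) = (z , z∈) , y≈zx

  -- The quotient of a nonzero y is itself nonzero, so the condition built into `∣` comes for free.
  multiple⇒∣ : ∀ {x y} → ¬ (y ≈ 0#) → Multiple x y → x ∣ y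
  multiple⇒∣ y≉0 ((z , z∈) , y≈zx) = z , z∈ , nonzeroˡ (≉-resp y≈zx y≉0) , y≈zx

  multiple-resp : ∀ {x x′ y y′} → x ≈ x′ → y ≈ y′ → Multiple x y → Multiple x′ y′
  multiple-resp x≈x′ y≈y′ (z , y≈zx) = z , trans (sym y≈y′) (trans y≈zx (*-congˡ x≈x′))

  multiple-neg : ∀ {x y} → Multiple x (- y) → Multiple x y
  multiple-neg {x} {y} ((z , z∈) , -y≈zx) = (- z , *ℤ-neg z∈) ,
    trans (sym (-‿involutive y)) (trans (-‿cong -y≈zx) (-‿distribˡ-* z x))

  unit-neg : ∀ {x} → Unit (- x) → Unit x
  unit-neg {x} (inj₁ -x≈1) = inj₂ (trans (sym (-‿involutive x)) (-‿cong -x≈1))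
  unit-neg {x} (inj₂ -x≈-1) = inj₁ (trans (sym (-‿involutive x)) (trans (-‿cong -x≈-1) (-‿involutive 1#)))

  unit-square : ∀ {x} → Unit x → x * x ≈ 1#
  unit-square (inj₁ x≈1) = trans (*-cong x≈1 x≈1) (*-identityˡ 1#)
  unit-square {x} (inj₂ x≈-1) = begin
    x * x          ≈⟨ *-cong x≈-1 x≈-1 ⟩
    - 1# * - 1#    ≈⟨ -‿distribˡ-* 1# (- 1#) ⟨
    - (1# * - 1#)  ≈⟨ -‿cong (*-identityˡ (- 1#)) ⟩
    - - 1#         ≈⟨ -‿involutive 1# ⟩
    1#             ∎

  unit-* : ∀ {x y} → Unit x → Unit y → Unit (x * y)
  unit-* {x} {y} (inj₁ x≈1) y-unit =
    Sum.map (trans xy≈y) (trans xy≈y) y-unit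
    where
    xy≈y : x * y ≈ y
    xy≈y = trans (*-congʳ x≈1) (*-identityˡ y)
  unit-* {x} {y} (inj₂ x≈-1) y-unit = unit-neg
    (Sum.map (trans -xy≈y) (trans -xy≈y) y-unit)
    where
    -xy≈y : - (x * y) ≈ y
    -xy≈y = begin
      - (x * y)    ≈⟨ -‿distribˡ-* x y ⟩
      - x * y      ≈⟨ *-congʳ (trans (-‿cong x≈-1) (-‿involutive 1#)) ⟩
      1# * y       ≈⟨ *-identityˡ y ⟩
      y            ∎

  unit? : ∀ x → Unit x ⊎ ¬ Unit x
  unit? x with ≈-decidable x 1# | ≈-decidable x (- 1#)
  ... | inj₁ x≈1 | _ = inj₁ (inj₁ x≈1)
  ... | inj₂ _   | inj₁ x≈-1 = inj₁ (inj₂ x≈-1)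
  ... | inj₂ x≉1 | inj₂ x≉-1 = inj₂ [ x≉1 , x≉-1 ]′

  irreducible⇒prime : ∀ {p} → *ℕ p → Irreducible p → IsPrime p
  irreducible⇒prime {p} p∈ (p≉0 , p-nonunit , irr) = p∈ , p-nonunit ∘ inj₁ , λ x x∈ → mk⇔
    (λ (z , z∈ , _ , p≈zx) → irr (x , x∈) (z , z∈) p≈zx)
    (multiple⇒∣ p≉0 ∘ divisor)
    where
    p∈ℤ = *ℕ⇒*ℤ p∈
    neg-* : ∀ t → - t ≈ - 1# * t
    neg-* t = trans (-‿cong (sym (*-identityˡ t))) (-‿distribˡ-* 1# t)
    divisor : ∀ {x} → x ≈ 1# ⊎ x ≈ - 1# ⊎ x ≈ p ⊎ x ≈ - p → Multiple x p
    divisor (inj₁ x≈1) = multiple-resp (sym x≈1) refl ((p , p∈ℤ) , sym (*-identityʳ p))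
    divisor (inj₂ (inj₁ x≈-1)) = multiple-neg (multiple-resp (sym x≈-1) refl
      ((p , p∈ℤ) , trans (neg-* p) (*-comm (- 1#) p)))
    divisor (inj₂ (inj₂ (inj₁ x≈p))) = multiple-resp (sym x≈p) refl ((1# , *ℤ-1) , sym (*-identityˡ p))
    divisor (inj₂ (inj₂ (inj₂ x≈-p))) = multiple-neg (multiple-resp (sym x≈-p) refl
      ((1# , *ℤ-1) , sym (*-identityˡ (- p))))

  -- This is x ≥ 0, as n may be 0; strictness comes from the nonzero elements to which it is
  -- applied. The equation is multiplied out to avoid inverses.
  Positive : Carrier → Set _
  Positive x = ∃[ m ] ∃[ n ] *ℕ m × *ℕ n × ¬ (m ≈ 0#) × x * m ≈ n

  Fraction : ˣ.Carrier → Set _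
  Fraction u = Σ[ a ∈ ˣ.Carrier ] Σ[ b ∈ ˣ.Carrier ]
    *ℤ (proj₁ a) × *ℤ (proj₁ b) × proj₁ u * proj₁ b ≈ proj₁ a

  abstract
    toFraction : ∀ u → Fraction u
    toFraction (u , u≉0) with fraction u
    ... | a , b , a∈ , b∈ , b≉0 , ub≈a = (a , ≉-resp ub≈a (nonzero-* u≉0 b≉0)) , (b , b≉0) , a∈ , b∈ , ub≈a

  //-* : ∀ (a b : ˣ.Carrier) → proj₁ (a ˣ.// b) * proj₁ b ≈ proj₁ a
  //-* a b = GroupProperties.//-rightDividesˡ *ℚˣ b a

  *≈⇒≈// : ∀ (u a b : ˣ.Carrier) → proj₁ u * proj₁ b ≈ proj₁ a → u ˣ.≈ a ˣ.// b
  *≈⇒≈// u a b ub≈a = cancelʳ (proj₂ b) (trans ub≈a (sym (//-* a b)))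

  -- The group `p ^*ℤ` and the valuation at a prime p

  module AtPrime (p : Primes) where
    π : Carrier
    π = proj₁ p

    π∈*ℕ : *ℕ π
    π∈*ℕ = proj₁ (proj₂ p)

    πᶻ : *Int
    πᶻ = π , *ℕ⇒*ℤ π∈*ℕ

    π-divisors : ∀ x → *ℤ x → x ∣ π ⇔ (x ≈ 1# ⊎ x ≈ - 1# ⊎ x ≈ π ⊎ x ≈ - π)
    π-divisors = proj₂ (proj₂ (proj₂ p))

    -- By the backward half of primality 1 divides π. The quotient, which `∣` requires to be
    -- nonzero, is π itself.
    π≉0 : ¬ (π ≈ 0#)
    π≉0 π≈0 with from (π-divisors 1# *ℤ-1) (inj₁ refl)
    ... | z , _ , z≉0 , π≈z*1 = z≉0 (trans (sym (*-identityʳ z)) (trans (sym π≈z*1) π≈0))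

    -- If π = - 1, then π and - π = 1 are both sums of four squares, which forces π = 0.
    π-nonunit : ¬ Unit π
    π-nonunit (inj₁ π≈1)  = proj₁ (proj₂ (proj₂ p)) π≈1
    π-nonunit (inj₂ π≈-1) = π≉0 (*ℕ-antisym π∈*ℕ
      (*ℕ-resp-≈ (sym (trans (-‿cong π≈-1) (-‿involutive 1#))) *ℕ-1))

    π-irreducible : Irreducible π
    π-irreducible = π≉0 , π-nonunit , λ (a , a∈) (b , b∈) π≈ba →
      to (π-divisors a a∈) (multiple⇒∣ π≉0 ((b , b∈) , π≈ba))

    power⇒*ℕ : ∀ {y} → Power π y → *ℕ y
    power⇒*ℕ (_ , y-fs , _) = fourSquares⇒*ℕ y-fs

    power⇒*ℤ : ∀ {y} → Power π y → *ℤ y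
    power⇒*ℤ = *ℕ⇒*ℤ ∘ power⇒*ℕ

    power-resp-≈ : ∀ {x y} → x ≈ y → Power π x → Power π y
    power-resp-≈ x≈y (x≉0 , x-fs , x-div) =
      ≉-resp x≈y x≉0 , *ℕ⇒fourSquares (*ℕ-resp-≈ x≈y (fourSquares⇒*ℕ x-fs)) ,
      λ w u y≈uw → x-div w u (trans x≈y y≈uw)

    -- Membership in `p ^*ℕ` tests only divisors in `*ℕ`. By Lagrange's theorem w or - w lies in
    -- `*ℕ` for every integer w, and this covers divisors of either sign.
    ^*ℕ⇒power : ∀ {y} → (p ^*ℕ) y → Power π y
    ^*ℕ⇒power (_ , inj₁ y≈1) = power-resp-≈ (sym y≈1) (power-1 πᶻ)
    ^*ℕ⇒power {y} (y∈ , inj₂ y-div) = y≉0 , *ℕ⇒fourSquares y∈ , divisor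
      where
      y≉0 : ¬ (y ≈ 0#)
      -- If y = 0, then y is an admissible divisor of itself with quotient 1, so p divides 0 with a
      -- nonzero quotient.
      y≉0 y≈0 with y-div y y∈ (λ y≈1 → 1≉0 (trans (sym y≈1) y≈0))
                   (λ y≈-1 → neg-nonzero 1≉0 (trans (sym y≈-1) y≈0))
                   (1# , *ℤ-1 , 1≉0 , sym (*-identityˡ y))
      ... | z , _ , z≉0 , y≈zπ = nonzero-* z≉0 π≉0 (trans (sym y≈zπ) y≈0)

      natural-divisor : ∀ {w} → *ℕ w → Multiple w y → Unit w ⊎ Multiple π w
      natural-divisor {w} w∈ w∣y with unit? w
      ... | inj₁ w-unit = inj₁ w-unit
      ... | inj₂ w-nonunit = inj₂ (∣⇒multiple
        (y-div w w∈ (w-nonunit ∘ inj₁) (w-nonunit ∘ inj₂) (multiple⇒∣ y≉0 w∣y)))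

      divisor : ∀ (w u : *Int) → y ≈ proj₁ u * proj₁ w → Unit (proj₁ w) ⊎ Multiple π (proj₁ w)
      divisor (w , w∈) (u , u∈) y≈uw = [ (λ w∈ℕ → natural-divisor w∈ℕ ((u , u∈) , y≈uw)) ,
        (λ -w∈ℕ → Sum.map unit-neg multiple-neg (natural-divisor -w∈ℕ ((- u , *ℤ-neg u∈) , y≈-u*-w))) ]′
        (*ℕ-total w∈)
        where
        y≈-u*-w : y ≈ - u * - w
        y≈-u*-w = begin
          y            ≈⟨ y≈uw ⟩
          u * w        ≈⟨ -‿involutive (u * w) ⟨
          - - (u * w)  ≈⟨ -‿cong (-‿distribʳ-* u w) ⟩
          - (u * - w)  ≈⟨ -‿distribˡ-* u (- w) ⟩
          - u * - w    ∎

    power⇒^*ℕ : ∀ {y} → Power π y → (p ^*ℕ) y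
    power⇒^*ℕ (y≉0 , y-fs , y-div) = fourSquares⇒*ℕ y-fs , inj₂ λ z z∈ z≉1 z≉-1 (q , q∈ , _ , y≈qz) →
      [ (λ z-unit → ⊥-elim ([ z≉1 , z≉-1 ]′ z-unit))
      , multiple⇒∣ (nonzeroʳ (≉-resp y≈qz y≉0)) ]′ (y-div (z , *ℕ⇒*ℤ z∈) (q , q∈) y≈qz)

    ^*ℤ-resp-≈ : ∀ u v → u ˣ.≈ v → (p ^*ℤ) u → (p ^*ℤ) v
    ^*ℤ-resp-≈ u v u≈v (inj₁ u∈) = inj₁ (power⇒^*ℕ (power-resp-≈ u≈v (^*ℕ⇒power u∈)))
    ^*ℤ-resp-≈ u v u≈v (inj₂ (x , x∈ , u≈x⁻¹)) = inj₂ (x , x∈ , trans (sym u≈v) u≈x⁻¹)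

    -- Two powers of p are comparable under divisibility, so their quotient is a power w or its
    -- inverse. This is the mixed case in the closure of `p ^*ℤ` under products.
    power-quotient : ∀ (x y : ˣ.Carrier) → Power π (proj₁ x) → Power π (proj₁ y) → (p ^*ℤ) (x ˣ.// y)
    power-quotient x y x-pow y-pow with power-compare πᶻ π-irreducible
      (_ , power⇒*ℤ x-pow) (_ , power⇒*ℤ y-pow) x-pow y-pow
    ... | (w , w∈) , w-pow , inj₁ x≈wy = inj₁ (power⇒^*ℕ (power-resp-≈
      (*≈⇒≈// (w , proj₁ w-pow) x y (sym x≈wy)) w-pow))
    ... | (w , w∈) , w-pow , inj₂ y≈wx = inj₂ ((w , proj₁ w-pow) , power⇒^*ℕ w-pow ,
      GroupProperties.inverseˡ-unique *ℚˣ (x ˣ.// y) (w , proj₁ w-pow) (cancelʳ (proj₂ y) (begin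
        proj₁ (x ˣ.// y) * w * proj₁ y  ≈⟨ solve 3 (λ q w y → q :* w :* y := w :* (q :* y)) refl (proj₁ (x ˣ.// y)) w (proj₁ y) ⟩
        w * (proj₁ (x ˣ.// y) * proj₁ y) ≈⟨ *-congˡ (//-* x y) ⟩
        w * proj₁ x                      ≈⟨ y≈wx ⟨
        proj₁ y                          ≈⟨ *-identityˡ (proj₁ y) ⟨
        1# * proj₁ y                     ∎)))

    ^*ℤ-isSubgroup : IsSubgroup *ℚˣ (p ^*ℤ)
    ^*ℤ-isSubgroup = record
      { ε-closed  = inj₁ (*ℕ-1 , inj₁ refl)
      ; ∙-closed  = ∙-closed
      ; ⁻¹-closed = ⁻¹-closed
      }
      where
      ∙-closed : ∀ u v → (p ^*ℤ) u → (p ^*ℤ) v → (p ^*ℤ) (u ˣ.∙ v)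
      ∙-closed u v (inj₁ u∈) (inj₁ v∈) = inj₁ (power⇒^*ℕ (power-* πᶻ
        (_ , *ℕ⇒*ℤ (proj₁ u∈)) (_ , *ℕ⇒*ℤ (proj₁ v∈)) (^*ℕ⇒power u∈) (^*ℕ⇒power v∈)))
      ∙-closed u v (inj₁ u∈) (inj₂ (y , y∈ , v≈y⁻¹)) = ^*ℤ-resp-≈ (u ˣ.// y) (u ˣ.∙ v)
        (*-congˡ (sym v≈y⁻¹)) (power-quotient u y (^*ℕ⇒power u∈) (^*ℕ⇒power y∈))
      ∙-closed u v (inj₂ (x , x∈ , u≈x⁻¹)) (inj₁ v∈) = ^*ℤ-resp-≈ (v ˣ.// x) (u ˣ.∙ v)
        (trans (*-comm _ _) (*-congʳ (sym u≈x⁻¹))) (power-quotient v x (^*ℕ⇒power v∈) (^*ℕ⇒power x∈))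
      ∙-closed u v (inj₂ (x , x∈ , u≈x⁻¹)) (inj₂ (y , y∈ , v≈y⁻¹)) = inj₂ (y ˣ.∙ x ,
        power⇒^*ℕ (power-* πᶻ (_ , *ℕ⇒*ℤ (proj₁ y∈)) (_ , *ℕ⇒*ℤ (proj₁ x∈)) (^*ℕ⇒power y∈) (^*ℕ⇒power x∈)) ,
        trans (*-cong u≈x⁻¹ v≈y⁻¹) (sym (GroupProperties.⁻¹-anti-homo-∙ *ℚˣ y x)))

      ⁻¹-closed : ∀ u → (p ^*ℤ) u → (p ^*ℤ) (u ˣ.⁻¹)
      ⁻¹-closed u (inj₁ u∈) = inj₂ (u , u∈ , refl)
      ⁻¹-closed u (inj₂ (x , x∈ , u≈x⁻¹)) = ^*ℤ-resp-≈ x (u ˣ.⁻¹)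
        (sym (trans (ˣ.⁻¹-cong {u} {x ˣ.⁻¹} u≈x⁻¹) (GroupProperties.⁻¹-involutive *ℚˣ x))) (inj₁ x∈)

    abstract
      exactPart : ∀ (x : ˣ.Carrier) → *ℤ (proj₁ x) → ˣ.Carrier
      exactPart (x , x≉0) x∈ =
        let (y , _) , (y≉0 , _) , _ = exact-exists πᶻ π-irreducible (*ℕ⇒fourSquares π∈*ℕ) (x , x∈) x≉0 in y , y≉0

      exactPart-power : ∀ (x : ˣ.Carrier) x∈ → Power π (proj₁ (exactPart x x∈))
      exactPart-power (x , x≉0) x∈ =
        let _ , y-pow , _ = exact-exists πᶻ π-irreducible (*ℕ⇒fourSquares π∈*ℕ) (x , x∈) x≉0 in y-pow

      exactPart-cofactor : ∀ (x : ˣ.Carrier) x∈ → ExactCofactor π (proj₁ x) (proj₁ (exactPart x x∈))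
      exactPart-cofactor (x , x≉0) x∈ =
        let _ , _ , exact = exact-exists πᶻ π-irreducible (*ℕ⇒fourSquares π∈*ℕ) (x , x∈) x≉0 in exact

    exactPart-unique : ∀ (x : ˣ.Carrier) x∈ {y} → Power π y → ExactCofactor π (proj₁ x) y → y ≈ proj₁ (exactPart x x∈)
    exactPart-unique x x∈ y-pow exact = exact-unique πᶻ π-irreducible (_ , x∈) (_ , power⇒*ℤ y-pow)
      (_ , power⇒*ℤ (exactPart-power x x∈)) y-pow (exactPart-power x x∈) exact (exactPart-cofactor x x∈)

    -- By uniqueness the chosen p-part depends neither on the representative nor on the proof of
    -- integrality.
    exactPart-cong : ∀ (x : ˣ.Carrier) x∈ (x′ : ˣ.Carrier) x′∈ → x ˣ.≈ x′ → exactPart x x∈ ˣ.≈ exactPart x′ x′∈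
    exactPart-cong x x∈ x′ x′∈ x≈x′ = exactPart-unique x′ x′∈ (exactPart-power x x∈)
      (let z , x≈zy , p∤z = exactPart-cofactor x x∈ in z , trans (sym x≈x′) x≈zy , p∤z)

    -- The product of the p-parts is a power of p whose cofactor z w is not divisible by p, by
    -- Euclid's lemma. Uniqueness identifies it with the p-part of the product.
    exactPart-* : ∀ (x : ˣ.Carrier) x∈ (y : ˣ.Carrier) y∈ xy∈ →
      exactPart (x ˣ.∙ y) xy∈ ˣ.≈ (exactPart x x∈ ˣ.∙ exactPart y y∈)
    exactPart-* x x∈ y y∈ xy∈ = sym (exactPart-unique (x ˣ.∙ y) xy∈
      (power-* πᶻ (_ , power⇒*ℤ (exactPart-power x x∈)) (_ , power⇒*ℤ (exactPart-power y y∈))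
        (exactPart-power x x∈) (exactPart-power y y∈))
      (product (exactPart-cofactor x x∈) (exactPart-cofactor y y∈)))
      where
      product : ∀ {x y a b} → ExactCofactor π x a → ExactCofactor π y b → ExactCofactor π (x * y) (a * b)
      product {a = a} {b} ((z , z∈) , x≈za , p∤z) ((w , w∈) , y≈wb , p∤w) =
        (z * w , *ℤ-* z∈ w∈) ,
        trans (*-cong x≈za y≈wb) (solve 4 (λ z a w b → z :* a :* (w :* b) := z :* w :* (a :* b)) refl z a w b) ,
        [ p∤z , p∤w ]′ ∘ euclid πᶻ π-irreducible (z , z∈) (w , w∈)

    exactPart-1 : ∀ 1∈ → exactPart ˣ.ε 1∈ ˣ.≈ ˣ.ε
    exactPart-1 1∈ = sym (exactPart-unique ˣ.ε 1∈ (power-1 πᶻ)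
      ((1# , *ℤ-1) , sym (*-identityˡ 1#) , λ ((k , k∈) , 1≈kπ) →
        π-nonunit (factor-of-1⇒unit (k , k∈) πᶻ (sym 1≈kπ))))

    abstract
      valuation : ˣ.Carrier → ˣ.Carrier
      valuation u = let a , b , a∈ , b∈ , _ = toFraction u in exactPart a a∈ ˣ.// exactPart b b∈

      -- Independence of the chosen fraction: if a′/b′ is the chosen one, then a′ b = a b′, and
      -- multiplicativity of the p-part gives the same relation between p-parts. Later computations
      -- use this instead of the choice.
      valuation-* : ∀ (u a b : ˣ.Carrier) a∈ b∈ → proj₁ u * proj₁ b ≈ proj₁ a →
        proj₁ (valuation u) * proj₁ (exactPart b b∈) ≈ proj₁ (exactPart a a∈)
      valuation-* u a b a∈ b∈ ub≈a = let a′ , b′ , a′∈ , b′∈ , ub′≈a′ = toFraction u in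
        cancelʳ (proj₂ (exactPart b′ b′∈)) (begin
          proj₁ (valuation u) * proj₁ (exactPart b b∈) * proj₁ (exactPart b′ b′∈)
            ≈⟨ solve 3 (λ v e e′ → v :* e :* e′ := v :* e′ :* e) refl
                (proj₁ (valuation u)) (proj₁ (exactPart b b∈)) (proj₁ (exactPart b′ b′∈)) ⟩
          proj₁ (valuation u) * proj₁ (exactPart b′ b′∈) * proj₁ (exactPart b b∈)
            ≈⟨ *-congʳ (//-* (exactPart a′ a′∈) (exactPart b′ b′∈)) ⟩
          proj₁ (exactPart a′ a′∈) * proj₁ (exactPart b b∈)
            ≈⟨ exactPart-* a′ a′∈ b b∈ (*ℤ-* a′∈ b∈) ⟨
          proj₁ (exactPart (a′ ˣ.∙ b) (*ℤ-* a′∈ b∈))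
            ≈⟨ exactPart-cong (a′ ˣ.∙ b) (*ℤ-* a′∈ b∈) (a ˣ.∙ b′) (*ℤ-* a∈ b′∈) (begin
              proj₁ a′ * proj₁ b             ≈⟨ *-congʳ ub′≈a′ ⟨
              proj₁ u * proj₁ b′ * proj₁ b   ≈⟨ solve 3 (λ u b′ b → u :* b′ :* b := u :* b :* b′) refl (proj₁ u) (proj₁ b′) (proj₁ b) ⟩
              proj₁ u * proj₁ b * proj₁ b′   ≈⟨ *-congʳ ub≈a ⟩
              proj₁ a * proj₁ b′             ∎) ⟩
          proj₁ (exactPart (a ˣ.∙ b′) (*ℤ-* a∈ b′∈))
            ≈⟨ exactPart-* a a∈ b′ b′∈ (*ℤ-* a∈ b′∈) ⟩
          proj₁ (exactPart a a∈) * proj₁ (exactPart b′ b′∈) ∎)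

      valuation-∈ : ∀ u → (p ^*ℤ) (valuation u)
      valuation-∈ u = let a , b , a∈ , b∈ , _ = toFraction u in
        power-quotient (exactPart a a∈) (exactPart b b∈) (exactPart-power a a∈) (exactPart-power b b∈)

    valuation-cong : ∀ u v → u ˣ.≈ v → valuation u ˣ.≈ valuation v
    valuation-cong u v u≈v = let a , b , a∈ , b∈ , vb≈a = toFraction v in
      cancelʳ (proj₂ (exactPart b b∈)) (trans
        (valuation-* u a b a∈ b∈ (trans (*-congʳ u≈v) vb≈a))
        (sym (valuation-* v a b a∈ b∈ vb≈a)))

    valuation-integer : ∀ (x : ˣ.Carrier) x∈ → valuation x ˣ.≈ exactPart x x∈
    valuation-integer x x∈ = begin
      proj₁ (valuation x)                               ≈⟨ *-identityʳ _ ⟨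
      proj₁ (valuation x) * 1#                          ≈⟨ *-congˡ (exactPart-1 *ℤ-1) ⟨
      proj₁ (valuation x) * proj₁ (exactPart ˣ.ε *ℤ-1)  ≈⟨ valuation-* x x ˣ.ε x∈ *ℤ-1 (*-identityʳ (proj₁ x)) ⟩
      proj₁ (exactPart x x∈)                            ∎

    valuation-homo : ∀ u v → valuation (u ˣ.∙ v) ˣ.≈ (valuation u ˣ.∙ valuation v)
    valuation-homo u v =
      let a , b , a∈ , b∈ , ub≈a = toFraction u
          a′ , b′ , a′∈ , b′∈ , vb′≈a′ = toFraction v
      in cancelʳ (proj₂ (exactPart b b∈ ˣ.∙ exactPart b′ b′∈)) (begin
        proj₁ (valuation (u ˣ.∙ v)) * (proj₁ (exactPart b b∈) * proj₁ (exactPart b′ b′∈))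
          ≈⟨ *-congˡ (exactPart-* b b∈ b′ b′∈ (*ℤ-* b∈ b′∈)) ⟨
        proj₁ (valuation (u ˣ.∙ v)) * proj₁ (exactPart (b ˣ.∙ b′) (*ℤ-* b∈ b′∈))
          ≈⟨ valuation-* (u ˣ.∙ v) (a ˣ.∙ a′) (b ˣ.∙ b′) (*ℤ-* a∈ a′∈) (*ℤ-* b∈ b′∈)
              (trans (interchange (proj₁ u) (proj₁ v) (proj₁ b) (proj₁ b′)) (*-cong ub≈a vb′≈a′)) ⟩
        proj₁ (exactPart (a ˣ.∙ a′) (*ℤ-* a∈ a′∈))
          ≈⟨ exactPart-* a a∈ a′ a′∈ (*ℤ-* a∈ a′∈) ⟩
        proj₁ (exactPart a a∈) * proj₁ (exactPart a′ a′∈)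
          ≈⟨ *-cong (valuation-* u a b a∈ b∈ ub≈a) (valuation-* v a′ b′ a′∈ b′∈ vb′≈a′) ⟨
        proj₁ (valuation u) * proj₁ (exactPart b b∈) * (proj₁ (valuation v) * proj₁ (exactPart b′ b′∈))
          ≈⟨ interchange (proj₁ (valuation u)) (proj₁ (valuation v)) (proj₁ (exactPart b b∈)) (proj₁ (exactPart b′ b′∈)) ⟨
        proj₁ (valuation u) * proj₁ (valuation v) * (proj₁ (exactPart b b∈) * proj₁ (exactPart b′ b′∈)) ∎)
      where
      interchange : ∀ u v b b′ → u * v * (b * b′) ≈ u * b * (v * b′)
      interchange = solve 4 (λ u v b b′ → u :* v :* (b :* b′) := u :* b :* (v :* b′)) refl

    ExactDivisor : Carrier → Carrier → Set _
    ExactDivisor x y = (p ^*ℕ) y × y ∣ x × ¬ (π * y ∣ x)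

    exactDivisor⇒cofactor : ∀ {x y} → ¬ (x ≈ 0#) → ExactDivisor x y → ExactCofactor π x y
    exactDivisor⇒cofactor {y = y} x≉0 (_ , (z , z∈ , _ , x≈zy) , πy∤x) = (z , z∈) , x≈zy ,
      λ ((k , k∈) , z≈kπ) → πy∤x (multiple⇒∣ x≉0
        ((k , k∈) , trans x≈zy (trans (*-congʳ z≈kπ) (*-assoc k π y))))

    cofactor⇒exactDivisor : ∀ {x y} → ¬ (x ≈ 0#) → Power π y → ExactCofactor π x y → ExactDivisor x y
    cofactor⇒exactDivisor {y = y} x≉0 y-pow (z , x≈zy , p∤z) = power⇒^*ℕ y-pow ,
      multiple⇒∣ x≉0 (z , x≈zy) , λ (k , k∈ , _ , x≈kπy) → p∤z ((k , k∈) ,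
        cancelʳ (proj₁ y-pow) (trans (sym x≈zy) (trans x≈kπy (sym (*-assoc k π y)))))

    valuation-is-d : Is-d p valuation
    valuation-is-d = record
      { d-cong        = valuation-cong
      ; d-on-integer  = λ x x∈ →
          (let y≈ = sym (valuation-integer x x∈)
               z , x≈zy , p∤z = exactPart-cofactor x x∈
           in cofactor⇒exactDivisor (proj₂ x) (power-resp-≈ y≈ (exactPart-power x x∈))
                (z , trans x≈zy (*-congˡ y≈) , p∤z)) ,
          λ y exact → trans
            (exactPart-unique x x∈ (^*ℕ⇒power (proj₁ exact)) (exactDivisor⇒cofactor (proj₂ x) exact))
            (sym (valuation-integer x x∈))
      ; d-on-quotient = λ a b a∈ b∈ → *≈⇒≈// (valuation (a ˣ.// b)) (valuation a) (valuation b) (begin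
          proj₁ (valuation (a ˣ.// b)) * proj₁ (valuation b)        ≈⟨ *-congˡ (valuation-integer b b∈) ⟩
          proj₁ (valuation (a ˣ.// b)) * proj₁ (exactPart b b∈)     ≈⟨ valuation-* (a ˣ.// b) a b a∈ b∈ (//-* a b) ⟩
          proj₁ (exactPart a a∈)                                    ≈⟨ valuation-integer a a∈ ⟨
          proj₁ (valuation a)                                       ∎)
      }

    -- On integers `d` is fixed by uniqueness of the p-part, hence also on quotients of integers,
    -- and every element is such a quotient. Claims about an arbitrary `d` thereby reduce to
    -- `valuation`.
    is-d-unique : ∀ {d} → Is-d p d → ∀ u → d u ˣ.≈ valuation u
    is-d-unique {d} is-d u = let a , b , a∈ , b∈ , ub≈a = toFraction u in
      cancelʳ (proj₂ (exactPart b b∈)) (begin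
        proj₁ (d u) * proj₁ (exactPart b b∈)       ≈⟨ *-cong (d-cong u (a ˣ.// b) (*≈⇒≈// u a b ub≈a)) (sym (on-integer b b∈)) ⟩
        proj₁ (d (a ˣ.// b)) * proj₁ (d b)         ≈⟨ *-congʳ (d-on-quotient a b a∈ b∈) ⟩
        proj₁ (d a ˣ.// d b) * proj₁ (d b)         ≈⟨ //-* (d a) (d b) ⟩
        proj₁ (d a)                                ≈⟨ on-integer a a∈ ⟩
        proj₁ (exactPart a a∈)                     ≈⟨ valuation-* u a b a∈ b∈ ub≈a ⟨
        proj₁ (valuation u) * proj₁ (exactPart b b∈) ∎)
      where
      open Is-d is-d using (d-cong; d-on-integer; d-on-quotient)
      on-integer : ∀ (x : ˣ.Carrier) x∈ → proj₁ (d x) ≈ proj₁ (exactPart x x∈)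
      on-integer x x∈ = let exact = proj₁ (d-on-integer x x∈) in
        exactPart-unique x x∈ (^*ℕ⇒power (proj₁ exact)) (exactDivisor⇒cofactor (proj₂ x) exact)

    -- As p does not divide b, the p-part of b is 1. Valuation 1 then makes the p-part of a equal to
    -- 1, so a is its own cofactor.
    valuation-one⇒∤ : ∀ (u a b : ˣ.Carrier) → *ℤ (proj₁ a) → *ℤ (proj₁ b) → proj₁ u * proj₁ b ≈ proj₁ a →
      valuation u ˣ.≈ ˣ.ε → ¬ Multiple π (proj₁ b) → ¬ Multiple π (proj₁ a)
    valuation-one⇒∤ u a b a∈ b∈ ub≈a v≈1 π∤b =
      let (z , _) , a≈z*e , π∤z = exactPart-cofactor a a∈ in
      π∤z ∘ multiple-resp refl (trans a≈z*e (trans (*-congˡ ea≈1) (*-identityʳ z)))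
      where
      eb≈1 : 1# ≈ proj₁ (exactPart b b∈)
      eb≈1 = exactPart-unique b b∈ (power-1 πᶻ) ((_ , b∈) , sym (*-identityʳ _) , π∤b)
      ea≈1 : proj₁ (exactPart a a∈) ≈ 1#
      ea≈1 = trans (sym (valuation-* u a b a∈ b∈ ub≈a)) (trans (*-cong v≈1 (sym eb≈1)) (*-identityˡ 1#))

  open AtPrime using (valuation)

  -- A p-part for p is also one for q, since `Power` and `ExactCofactor` see the prime only up to
  -- `≈`. Membership of the family in the product requires this.
  valuation-resp-prime : ∀ (p q : Primes) → proj₁ p ≈ proj₁ q → ∀ u → valuation p u ˣ.≈ valuation q u
  valuation-resp-prime p q p≈q u =
    let a , b , a∈ , b∈ , ub≈a = toFraction u in
    cancelʳ (proj₂ (AtPrime.exactPart q b b∈)) (begin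
      proj₁ (valuation p u) * proj₁ (AtPrime.exactPart q b b∈)  ≈⟨ *-congˡ (exactPart-resp b b∈) ⟨
      proj₁ (valuation p u) * proj₁ (AtPrime.exactPart p b b∈)  ≈⟨ AtPrime.valuation-* p u a b a∈ b∈ ub≈a ⟩
      proj₁ (AtPrime.exactPart p a a∈)                          ≈⟨ exactPart-resp a a∈ ⟩
      proj₁ (AtPrime.exactPart q a a∈)                          ≈⟨ AtPrime.valuation-* q u a b a∈ b∈ ub≈a ⟨
      proj₁ (valuation q u) * proj₁ (AtPrime.exactPart q b b∈)  ∎)
    where
    exactPart-resp : ∀ (x : ˣ.Carrier) x∈ → AtPrime.exactPart p x x∈ ˣ.≈ AtPrime.exactPart q x x∈
    exactPart-resp x x∈ = AtPrime.exactPart-unique q x x∈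
      (let y≉0 , y-fs , y-div = AtPrime.exactPart-power p x x∈
       in y≉0 , y-fs , λ w u y≈uw → Sum.map₂ (multiple-resp p≈q refl) (y-div w u y≈uw))
      (let z , x≈zy , p∤z = AtPrime.exactPart-cofactor p x x∈
       in z , x≈zy , p∤z ∘ multiple-resp (sym p≈q) refl)

  -- The common kernel of all valuations

  Coprime : Carrier → Carrier → Set _
  Coprime x y = ∀ (d : *Int) → Multiple (proj₁ d) x → Multiple (proj₁ d) y → Unit (proj₁ d)

  -- A nonunit integer has a prime divisor p, at which the fraction u = a/b in lowest terms has nontrivial valuation.
  numerator-unit : ∀ (u a b : ˣ.Carrier) → *ℤ (proj₁ a) → *ℤ (proj₁ b) → proj₁ u * proj₁ b ≈ proj₁ a →
    Coprime (proj₁ a) (proj₁ b) → (∀ p → valuation p u ˣ.≈ ˣ.ε) → Unit (proj₁ a)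
  numerator-unit u a b a∈ b∈ ub≈a coprime v≈1 with unit? (proj₁ a)
  ... | inj₁ a-unit = a-unit
  ... | inj₂ a-nonunit with prime-factor (_ , a∈) (proj₂ a) a-nonunit
  ... | p , p-irr@(_ , p-nonunit , _) , p-fs , p∣a = ⊥-elim
    (AtPrime.valuation-one⇒∤ p′ u a b a∈ b∈ ub≈a (v≈1 p′) (p-nonunit ∘ coprime p p∣a) p∣a)
    where
    p′ : Primes
    p′ = proj₁ p , irreducible⇒prime (fourSquares⇒*ℕ p-fs) p-irr

  inverse-swap : ∀ (u a b : ˣ.Carrier) → proj₁ u * proj₁ b ≈ proj₁ a → proj₁ (u ˣ.⁻¹) * proj₁ a ≈ proj₁ b
  inverse-swap u a b ub≈a = trans (*-congˡ (sym ub≈a)) (GroupProperties.\\-leftDividesʳ *ℚˣ u b)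

  -- In lowest terms b′ is the numerator of the inverse of u, whose valuations are 1 as well, so
  -- `numerator-unit` applies to a′ and to b′. As b′ is then its own inverse, u = a′ b′.
  kernel-fraction : ∀ (u : ˣ.Carrier) → Fraction u → (∀ p → valuation p u ˣ.≈ ˣ.ε) → Unit (proj₁ u)
  kernel-fraction u ((a , a≉0) , (b , b≉0) , a∈ , b∈ , ub≈a) v≈1 with coprime-cofactors (a , a∈) (b , b∈)
  ... | (g , _) , (a′ , a′∈) , (b′ , b′∈) , a≈ga′ , b≈gb′ , coprime =
    unit-resp u≈a′b′ (unit-* a′-unit b′-unit)
    where
    unit-resp : ∀ {x y} → x ≈ y → Unit x → Unit y
    unit-resp x≈y = Sum.map (trans (sym x≈y)) (trans (sym x≈y))

    A B : ˣ.Carrier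
    A = a′ , nonzeroʳ (≉-resp a≈ga′ a≉0)
    B = b′ , nonzeroʳ (≉-resp b≈gb′ b≉0)

    ub′≈a′ : proj₁ u * b′ ≈ a′
    ub′≈a′ = cancelʳ (nonzeroˡ (≉-resp a≈ga′ a≉0)) (begin
      proj₁ u * b′ * g      ≈⟨ trans (*-assoc (proj₁ u) b′ g) (*-congˡ (*-comm b′ g)) ⟩
      proj₁ u * (g * b′)    ≈⟨ *-congˡ b≈gb′ ⟨
      proj₁ u * b           ≈⟨ ub≈a ⟩
      a                     ≈⟨ a≈ga′ ⟩
      g * a′                ≈⟨ *-comm g a′ ⟩
      a′ * g                ∎)

    a′-unit : Unit a′
    a′-unit = numerator-unit u A B a′∈ b′∈ ub′≈a′ coprime v≈1

    v⁻¹≈1 : ∀ p → valuation p (u ˣ.⁻¹) ˣ.≈ ˣ.ε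
    v⁻¹≈1 p = trans (IsGroupHomomorphism.⁻¹-homo
        (multiplicative⇒homomorphism *ℚˣ *ℚˣ (valuation p)
          (λ {x} {y} → AtPrime.valuation-cong p x y) (AtPrime.valuation-homo p)) u)
      (trans (ˣ.⁻¹-cong {valuation p u} {ˣ.ε} (v≈1 p)) (GroupProperties.ε⁻¹≈ε *ℚˣ))

    b′-unit : Unit b′
    b′-unit = numerator-unit (u ˣ.⁻¹) B A b′∈ a′∈ (inverse-swap u A B ub′≈a′)
      (λ d d∣b′ d∣a′ → coprime d d∣a′ d∣b′) v⁻¹≈1

    u≈a′b′ : a′ * b′ ≈ proj₁ u
    u≈a′b′ = begin
      a′ * b′                ≈⟨ *-congʳ ub′≈a′ ⟨
      proj₁ u * b′ * b′      ≈⟨ *-assoc (proj₁ u) b′ b′ ⟩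
      proj₁ u * (b′ * b′)    ≈⟨ *-congˡ (unit-square b′-unit) ⟩
      proj₁ u * 1#           ≈⟨ *-identityʳ (proj₁ u) ⟩
      proj₁ u                ∎

  abstract
    kernel : ∀ (u : ˣ.Carrier) → (∀ p → valuation p u ˣ.≈ ˣ.ε) → Unit (proj₁ u)
    kernel u = kernel-fraction u (toFraction u)

  -- The order and the sign

  positive-resp-≈ : ∀ {x y} → x ≈ y → Positive x → Positive y
  positive-resp-≈ x≈y (m , n , m∈ , n∈ , m≉0 , xm≈n) =
    m , n , m∈ , n∈ , m≉0 , trans (*-congʳ (sym x≈y)) xm≈n

  positive-* : ∀ {x y} → Positive x → Positive y → Positive (x * y)
  positive-* {x} {y} (m , n , m∈ , n∈ , m≉0 , xm≈n) (m′ , n′ , m′∈ , n′∈ , m′≉0 , ym′≈n′) =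
    m * m′ , n * n′ , *ℕ-* m∈ m′∈ , *ℕ-* n∈ n′∈ , nonzero-* m≉0 m′≉0 ,
    trans (solve 4 (λ x y m m′ → x :* y :* (m :* m′) := x :* m :* (y :* m′)) refl x y m m′) (*-cong xm≈n ym′≈n′)

  -- Over the common denominator m m′ the numerator n m′ and its negative n′ m both lie in `*ℕ`, so
  -- they vanish.
  positive-antisym : ∀ {x} → Positive x → Positive (- x) → x ≈ 0#
  positive-antisym {x} (m , n , m∈ , n∈ , m≉0 , xm≈n) (m′ , n′ , m′∈ , n′∈ , m′≉0 , -xm′≈n′) =
    cancelʳ (nonzero-* m≉0 m′≉0) (begin
      x * (m * m′)   ≈⟨ *-assoc x m m′ ⟨
      x * m * m′     ≈⟨ *-congʳ xm≈n ⟩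
      n * m′         ≈⟨ *ℕ-antisym (*ℕ-* n∈ m′∈) (*ℕ-resp-≈ (sym -nm′≈n′m) (*ℕ-* n′∈ m∈)) ⟩
      0#             ≈⟨ zeroˡ (m * m′) ⟨
      0# * (m * m′)  ∎)
    where
    -nm′≈n′m : - (n * m′) ≈ n′ * m
    -nm′≈n′m = begin
      - (n * m′)       ≈⟨ -‿cong (*-congʳ xm≈n) ⟨
      - (x * m * m′)   ≈⟨ -‿cong (solve 3 (λ x m m′ → x :* m :* m′ := x :* m′ :* m) refl x m m′) ⟩
      - (x * m′ * m)   ≈⟨ -‿distribˡ-* (x * m′) m ⟩
      - (x * m′) * m   ≈⟨ *-congʳ (-‿distribˡ-* x m′) ⟩
      - x * m′ * m     ≈⟨ *-congʳ -xm′≈n′ ⟩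
      n′ * m           ∎

  -x*-y≈x*y : ∀ x y → - x * - y ≈ x * y
  -x*-y≈x*y x y = begin
    - x * - y      ≈⟨ -‿distribˡ-* x (- y) ⟨
    - (x * - y)    ≈⟨ -‿cong (-‿distribʳ-* x y) ⟨
    - - (x * y)    ≈⟨ -‿involutive (x * y) ⟩
    x * y          ∎

  abstract
    positive-total : ∀ (u : ˣ.Carrier) → Positive (proj₁ u) ⊎ Positive (- proj₁ u)
    positive-total u with toFraction u
    ... | (a , _) , (b , b≉0) , a∈ , b∈ , ub≈a with *ℕ-total a∈ | *ℕ-total b∈
    ... | inj₁ a∈ℕ  | inj₁ b∈ℕ  = inj₁ (b , a , b∈ℕ , a∈ℕ , b≉0 , ub≈a)
    ... | inj₂ -a∈ℕ | inj₁ b∈ℕ  = inj₂ (b , - a , b∈ℕ , -a∈ℕ , b≉0 ,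
      trans (sym (-‿distribˡ-* (proj₁ u) b)) (-‿cong ub≈a))
    ... | inj₁ a∈ℕ  | inj₂ -b∈ℕ = inj₂ (- b , a , -b∈ℕ , a∈ℕ , neg-nonzero b≉0 ,
      trans (-x*-y≈x*y (proj₁ u) b) ub≈a)
    ... | inj₂ -a∈ℕ | inj₂ -b∈ℕ = inj₁ (- b , - a , -b∈ℕ , -a∈ℕ , neg-nonzero b≉0 ,
      trans (sym (-‿distribʳ-* (proj₁ u) b)) (-‿cong ub≈a))

  positive-square : ∀ (u : ˣ.Carrier) → Positive (proj₁ u * proj₁ u)
  positive-square u =
    [ (λ u>0 → positive-* u>0 u>0)
    , (λ -u>0 → positive-resp-≈ (-x*-y≈x*y (proj₁ u) (proj₁ u)) (positive-* -u>0 -u>0)) ]′ (positive-total u)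

  <⇒positive-difference : ∀ {x y} → x < y → Positive (y - x)
  <⇒positive-difference {x} {y} (a₁ , a₂ , b₁ , b₂ , _ , _ , b₁∈ , b₂∈ , x≈ , y≈ , difference∈ , _) =
    proj₁ (b₁ ˣ.∙ b₂) , _ , *ℕ-* b₁∈ b₂∈ , difference∈ , proj₂ (b₁ ˣ.∙ b₂) , (begin
      (y - x) * (B₁ * B₂)                    ≈⟨ distribʳ (B₁ * B₂) y (- x) ⟩
      y * (B₁ * B₂) + - x * (B₁ * B₂)        ≈⟨ +-congˡ (-‿distribˡ-* x (B₁ * B₂)) ⟨
      y * (B₁ * B₂) - x * (B₁ * B₂)
        ≈⟨ +-cong (solve 3 (λ y b₁ b₂ → y :* (b₁ :* b₂) := y :* b₂ :* b₁) refl y B₁ B₂) (-‿cong (sym (*-assoc x B₁ B₂))) ⟩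
      y * B₂ * B₁ - x * B₁ * B₂              ≈⟨ +-cong (*-congʳ (clear y a₂ b₂ y≈)) (-‿cong (*-congʳ (clear x a₁ b₁ x≈))) ⟩
      a₂ * B₁ - a₁ * B₂                      ∎)
    where
    B₁ = proj₁ b₁
    B₂ = proj₁ b₂
    clear : ∀ z a (b : ˣ.Carrier) → z ≈ a * proj₁ (b ˣ.⁻¹) → z * proj₁ b ≈ a
    clear z a b z≈ = trans (*-congʳ z≈)
      (trans (*-assoc a _ _) (trans (*-congˡ (ˣ.inverseˡ b)) (*-identityʳ a)))

  0<⇒positive : ∀ {x} → 0# < x → Positive x
  0<⇒positive 0<x = positive-resp-≈ (trans (+-congˡ -0#≈0#) (+-identityʳ _)) (<⇒positive-difference 0<x)

  <0⇒negative : ∀ {x} → x < 0# → Positive (- x)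
  <0⇒negative x<0 = positive-resp-≈ (+-identityˡ _) (<⇒positive-difference x<0)

  positive⇒0< : ∀ {x} → ¬ (x ≈ 0#) → Positive x → 0# < x
  positive⇒0< {x} x≉0 (m , n , m∈ , n∈ , m≉0 , xm≈n) =
    -- The fractions compared are 0/1 and n/m, so the difference to be found in `*ℕ` is n * 1 - 0 *
    -- m = n.
    0# , n , ˣ.ε , (m , m≉0) , *ℤ-0 , *ℕ⇒*ℤ n∈ , *ℕ-1 , m∈ ,
    sym (zeroˡ _) ,
    *≈⇒≈// (x , x≉0) (n , ≉-resp xm≈n (nonzero-* x≉0 m≉0)) (m , m≉0) xm≈n ,
    *ℕ-resp-≈ (sym (begin
      n * 1# - 0# * m  ≈⟨ +-cong (*-identityʳ n) (trans (-‿cong (zeroˡ m)) -0#≈0#) ⟩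
      n + 0#           ≈⟨ +-identityʳ n ⟩
      n                ∎)) n∈ ,
    λ 0≈x → x≉0 (sym 0≈x)

  signOf : ∀ {x} → Positive x ⊎ Positive (- x) → Sign
  signOf (inj₁ _) = Sign.+
  signOf (inj₂ _) = Sign.-

  sign : ˣ.Carrier → Sign
  sign u = signOf (positive-total u)

  sign-is-sgn : Is-sgn sign
  sign-is-sgn = record { sgn-positive = positive ; sgn-negative = negative }
    where
    positive : ∀ (u : ˣ.Carrier) → 0# < proj₁ u → sign u ≡ Sign.+
    positive u 0<u with positive-total u
    ... | inj₁ _ = ≡.refl
    ... | inj₂ -u>0 = ⊥-elim (proj₂ u (positive-antisym (0<⇒positive 0<u) -u>0))
    negative : ∀ (u : ˣ.Carrier) → proj₁ u < 0# → sign u ≡ Sign.-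
    negative u u<0 with positive-total u
    ... | inj₁ u>0 = ⊥-elim (proj₂ u (positive-antisym u>0 (<0⇒negative u<0)))
    ... | inj₂ _ = ≡.refl

  negative⇒<0 : ∀ {x} → ¬ (x ≈ 0#) → Positive (- x) → x < 0#
  negative⇒<0 {x} x≉0 (m , n , m∈ , n∈ , m≉0 , -xm≈n) =
    -- The fractions compared are - n/m and 0/1; the difference 0 * m - (- n) * 1 is again n.
    - n , 0# , (m , m≉0) , ˣ.ε , *ℤ-neg (*ℕ⇒*ℤ n∈) , *ℤ-0 , m∈ , *ℕ-1 ,
    *≈⇒≈// (x , x≉0) (- n , ≉-resp xm≈-n (nonzero-* x≉0 m≉0)) (m , m≉0) xm≈-n ,
    sym (zeroˡ _) ,
    *ℕ-resp-≈ (sym (begin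
      0# * m - - n * 1#   ≈⟨ +-cong (zeroˡ m) (-‿cong (*-identityʳ (- n))) ⟩
      0# + - - n          ≈⟨ +-identityˡ (- - n) ⟩
      - - n               ≈⟨ -‿involutive n ⟩
      n                   ∎)) n∈ ,
    x≉0
    where
    xm≈-n : x * m ≈ - n
    xm≈-n = trans (sym (-‿involutive (x * m))) (-‿cong (trans (-‿distribˡ-* x m) -xm≈n))

  module _ {sgn : ˣ.Carrier → Sign} (is-sgn : Is-sgn sgn) where

    abstract
      -- `Is-sgn` prescribes values only on positive and on negative elements. Totality of the order
      -- shows that these are all, so any such `sgn` is determined, and that it respects `≈` and
      -- products can be derived.
      sgn-cases : ∀ (u : ˣ.Carrier) → (Positive (proj₁ u) × sgn u ≡ Sign.+) ⊎ (Positive (- proj₁ u) × sgn u ≡ Sign.-)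
      sgn-cases u = Sum.map
        (λ u>0 → u>0 , Is-sgn.sgn-positive is-sgn u (positive⇒0< (proj₂ u) u>0))
        (λ u<0 → u<0 , Is-sgn.sgn-negative is-sgn u (negative⇒<0 (proj₂ u) u<0))
        (positive-total u)

    positive⇒sgn≡+ : ∀ (u : ˣ.Carrier) → Positive (proj₁ u) → sgn u ≡ Sign.+
    positive⇒sgn≡+ u u>0 = Is-sgn.sgn-positive is-sgn u (positive⇒0< (proj₂ u) u>0)

    negative⇒sgn≡- : ∀ (u : ˣ.Carrier) → Positive (- proj₁ u) → sgn u ≡ Sign.-
    negative⇒sgn≡- u u<0 = Is-sgn.sgn-negative is-sgn u (negative⇒<0 (proj₂ u) u<0)

    sgn-cong : ∀ u v → u ˣ.≈ v → sgn u ≡ sgn v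
    sgn-cong u v u≈v with sgn-cases u
    ... | inj₁ (u>0 , sgn≡+) = ≡.trans sgn≡+ (≡.sym (positive⇒sgn≡+ v (positive-resp-≈ u≈v u>0)))
    ... | inj₂ (u<0 , sgn≡-) = ≡.trans sgn≡- (≡.sym (negative⇒sgn≡- v (positive-resp-≈ (-‿cong u≈v) u<0)))

    sgn-* : ∀ u v → sgn (u ˣ.∙ v) ≡ sgn u *ˢ sgn v
    sgn-* u v with sgn-cases u | sgn-cases v
    ... | inj₁ (u>0 , su) | inj₁ (v>0 , sv) rewrite su | sv = positive⇒sgn≡+ (u ˣ.∙ v) (positive-* u>0 v>0)
    ... | inj₁ (u>0 , su) | inj₂ (v<0 , sv) rewrite su | sv = negative⇒sgn≡- (u ˣ.∙ v)
      (positive-resp-≈ (sym (-‿distribʳ-* (proj₁ u) (proj₁ v))) (positive-* u>0 v<0))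
    ... | inj₂ (u<0 , su) | inj₁ (v>0 , sv) rewrite su | sv = negative⇒sgn≡- (u ˣ.∙ v)
      (positive-resp-≈ (sym (-‿distribˡ-* (proj₁ u) (proj₁ v))) (positive-* u<0 v>0))
    ... | inj₂ (u<0 , su) | inj₂ (v<0 , sv) rewrite su | sv = positive⇒sgn≡+ (u ˣ.∙ v)
      (positive-resp-≈ (-x*-y≈x*y (proj₁ u) (proj₁ v)) (positive-* u<0 v<0))

    sgn-≡⇒positive : ∀ (u v : ˣ.Carrier) → sgn u ≡ sgn v → Positive (proj₁ u * proj₁ v)
    sgn-≡⇒positive u v eq with sgn-cases u | sgn-cases v
    ... | inj₁ (u>0 , _) | inj₁ (v>0 , _) = positive-* u>0 v>0
    ... | inj₂ (u<0 , _) | inj₂ (v<0 , _) = positive-resp-≈ (-x*-y≈x*y (proj₁ u) (proj₁ v)) (positive-* u<0 v<0)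
    ... | inj₁ (_ , su) | inj₂ (_ , sv) with () ← ≡.trans (≡.sym su) (≡.trans eq sv)
    ... | inj₂ (_ , su) | inj₁ (_ , sv) with () ← ≡.trans (≡.sym su) (≡.trans eq sv)

  -- Injectivity and the final homomorphism

  injective : ∀ (u v : ˣ.Carrier) → (∀ p → valuation p u ˣ.≈ valuation p v) → Positive (proj₁ u * proj₁ v) → u ˣ.≈ v
  injective u v vu≈vv uv>0 = [ equal , ⊥-elim ∘ opposite ]′ (kernel (u ˣ.// v) ratio-one)
    where
    ratio = proj₁ (u ˣ.// v)

    ratio-one : ∀ p → valuation p (u ˣ.// v) ˣ.≈ ˣ.ε
    ratio-one p = cancelʳ (proj₂ (valuation p v)) (begin
      proj₁ (valuation p (u ˣ.// v)) * proj₁ (valuation p v)   ≈⟨ AtPrime.valuation-homo p (u ˣ.// v) v ⟨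
      proj₁ (valuation p ((u ˣ.// v) ˣ.∙ v))                   ≈⟨ AtPrime.valuation-cong p ((u ˣ.// v) ˣ.∙ v) u (//-* u v) ⟩
      proj₁ (valuation p u)                                    ≈⟨ vu≈vv p ⟩
      proj₁ (valuation p v)                                    ≈⟨ *-identityˡ (proj₁ (valuation p v)) ⟨
      1# * proj₁ (valuation p v)                               ∎)

    equal : ratio ≈ 1# → u ˣ.≈ v
    equal ratio≈1 = trans (sym (//-* u v)) (trans (*-congʳ ratio≈1) (*-identityˡ (proj₁ v)))

    -- A ratio of - 1 gives u v = - v². Then v² and - v² are both nonnegative, forcing v² = 0
    -- although v is nonzero.
    opposite : ¬ (ratio ≈ - 1#)
    opposite ratio≈-1 = proj₂ (v ˣ.∙ v) (positive-antisym (positive-square v) (positive-resp-≈ (begin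
      proj₁ u * proj₁ v              ≈⟨ *-congʳ (//-* u v) ⟨
      ratio * proj₁ v * proj₁ v      ≈⟨ *-congʳ (*-congʳ ratio≈-1) ⟩
      - 1# * proj₁ v * proj₁ v       ≈⟨ *-congʳ (-‿distribˡ-* 1# (proj₁ v)) ⟨
      - (1# * proj₁ v) * proj₁ v     ≈⟨ *-congʳ (-‿cong (*-identityˡ (proj₁ v))) ⟩
      - proj₁ v * proj₁ v            ≈⟨ -‿distribˡ-* (proj₁ v) (proj₁ v) ⟨
      - (proj₁ v * proj₁ v)          ∎) uv>0))

  module _ (d : Primes → ˣ.Carrier → ˣ.Carrier) (is-d : ∀ p → Is-d p (d p))
           (sgn : ˣ.Carrier → Sign) (is-sgn : Is-sgn sgn) where

    d≈valuation : ∀ p u → d p u ˣ.≈ valuation p u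
    d≈valuation p = AtPrime.is-d-unique p (is-d p)

    d-homo : ∀ p u v → d p (u ˣ.∙ v) ˣ.≈ (d p u ˣ.∙ d p v)
    d-homo p u v = trans (d≈valuation p (u ˣ.∙ v)) (trans (AtPrime.valuation-homo p u v)
      (sym (*-cong (d≈valuation p u) (d≈valuation p v))))

    d-injective : ∀ (u v : ˣ.Carrier) → (∀ p → d p u ˣ.≈ d p v) → Positive (proj₁ u * proj₁ v) → u ˣ.≈ v
    d-injective u v du≈dv = injective u v λ p →
      trans (sym (d≈valuation p u)) (trans (du≈dv p) (d≈valuation p v))

    equality-criterion : ∀ (u v : ˣ.Carrier) →
      u ˣ.≈ v ⇔ ((∀ p → d p u ˣ.≈ d p v) × 0# < proj₁ u * proj₁ v)
    equality-criterion u v = mk⇔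
      (λ u≈v → (λ p → Is-d.d-cong (is-d p) u v u≈v) ,
        positive⇒0< (proj₂ (u ˣ.∙ v)) (positive-resp-≈ (*-congˡ u≈v) (positive-square u)))
      (λ (du≈dv , 0<uv) → d-injective u v du≈dv (0<⇒positive 0<uv))

    d-inProduct : ∀ u → InProduct (λ p → d p u)
    d-inProduct u =
      (λ p → AtPrime.^*ℤ-resp-≈ p (valuation p u) (d p u) (sym (d≈valuation p u)) (AtPrime.valuation-∈ p u)) ,
      (λ p q p≈q → trans (d≈valuation p u) (trans (valuation-resp-prime p q p≈q u) (sym (d≈valuation q u))))

    isMonomorphism : IsGroupMonomorphism ˣ.rawGroup
      (Group.rawGroup (productGroup AtPrime.^*ℤ-isSubgroup ×ᴳ signGroup))
      (λ u → ((λ p → d p u) , d-inProduct u) , sgn u)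
    isMonomorphism = record
      { isGroupHomomorphism = multiplicative⇒homomorphism *ℚˣ (productGroup AtPrime.^*ℤ-isSubgroup ×ᴳ signGroup) _
          (λ {u} {v} u≈v → (λ p → Is-d.d-cong (is-d p) u v u≈v) , sgn-cong is-sgn u v u≈v)
          (λ u v → (λ p → d-homo p u v) , sgn-* is-sgn u v)
      ; injective = λ {u} {v} (du≈dv , sgn≡) → d-injective u v du≈dv (sgn-≡⇒positive is-sgn u v sgn≡)
      }

theorem3p2 : ∀ {c ℓ} (*ℚ : Field c ℓ) →
  ElementarilyEquivalent (Field.rawRing *ℚ) +-*-rawRing →
  (Z : Formula 1) → DefinesℤInℚ Z →
  let open Field *ℚ
      open Arithmetic *ℚ Z
  in
  -- the objects named in the statement are well defined
  Σ[ sub ∈ (∀ p → IsSubgroup *ℚˣ (p ^*ℤ)) ]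
  (Σ[ d ∈ (Primes → ˣ.Carrier → ˣ.Carrier) ] (∀ p → Is-d p (d p))) ×
  (Σ[ sgn ∈ (ˣ.Carrier → Sign) ] Is-sgn sgn) ×
  (∀ (d : Primes → ˣ.Carrier → ˣ.Carrier) → (∀ p → Is-d p (d p)) →
   ∀ (sgn : ˣ.Carrier → Sign) → Is-sgn sgn →
    (∀ (a₀ a₁ : ˣ.Carrier) →
      proj₁ a₀ ≈ proj₁ a₁ ⇔
      ((∀ p → d p a₀ ˣ.≈ d p a₁) × 0# < proj₁ a₀ * proj₁ a₁))
    ×
    (Σ[ d∈∏ ∈ (∀ a → InProduct (λ p → d p a)) ]
      IsGroupMonomorphism ˣ.rawGroup
        (Group.rawGroup (productGroup sub ×ᴳ signGroup))
        (λ a → ((λ p → d p a) , d∈∏ a) , sgn a)))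
theorem3p2 *ℚ *ℚ≡ℚ Z Z-defines-ℤ =
  AtPrime.^*ℤ-isSubgroup ,
  (AtPrime.valuation , AtPrime.valuation-is-d) ,
  (sign , sign-is-sgn) ,
  λ d is-d sgn is-sgn → equality-criterion d is-d sgn is-sgn ,
    d-inProduct d is-d sgn is-sgn , isMonomorphism d is-d sgn is-sgn
  where open NonstandardRationals *ℚ *ℚ≡ℚ Z Z-defines-ℤ
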